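{- The class $\mathcal D$ of all finite diversities has coherent EPPA.
   Context: A diversity is a set $A$ with a function $d$ from the finite subsets of $A$ to $\mathbb R^{\ge 0}$ such that for all finite $X,Y,Z\subseteq A$: $d(X)=0$ iff $|X|\le 1$, and if $Y\neq\emptyset$ then $d(X\cup Y)+d(Y\cup Z)\ge d(X\cup Z)$. A diversity is viewed as a relational structure in the language with an $n$-ary relation symbol $R_{n,r}$ for every integer $n\ge 2$ and every $r\in\mathbb R^{>0}$, where $R_{n,r}$ holds exactly on the $n$-tuples of pairwise distinct elements whose underlying set $X$ satisfies $d(X)=r$; substructures, embeddings and (partial) automorphisms are taken with respect to this structure (so embeddings are injective maps preserving $d$). A partial automorphism of $\mathbf A$ is an isomorphism between two substructures of $\mathbf A$. An EPPA-witness for $\mathbf A$ is a structure $\mathbf B\supseteq\mathbf A$ (as substructure) such that every partial automorphism of $\mathbf A$ extends to an automorphism of $\mathbf B$. It is coherent if there is a map $\Psi$ from partial automorphisms of $\mathbf A$ to $\mathrm{Aut}(\mathbf B)$, with $\Psi(f)$ extending $f$, such that whenever $f,g$ are partial automorphisms with $\mathrm{Dom}(g)=\mathrm{Range}(f)$, $\Psi(g\circ f)=\Psi(g)\circ\Psi(f)$. A class $\mathcal C$ of finite structures has coherent EPPA if every $\mathbf A\in\mathcal C$ has a coherent EPPA-witness in $\mathcal C$. -}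

module Defs where

open import Level using (0ℓ)
open import Data.Nat using (ℕ) renaming (_≤_ to _≤ℕ_)
open import Data.Bool using (Bool; true; false; _∧_)
open import Data.Maybe using (Maybe; just; nothing)
open import Data.Fin using (Fin; _≟_)
open import Data.Fin.Subset using (Subset; _∈_; _⊆_; _∪_; ∣_∣; Nonempty)
open import Data.Fin.Subset.Properties using (_∈?_)
open import Data.Fin.Properties using (any?)
open import Data.Vec using (Vec; lookup; tabulate)
open import Data.Product using (Σ; ∃; _×_; _,_)
open import Relation.Nullary using (¬_; Dec; yes; no)
open import Relation.Nullary.Decidable using (⌊_⌋; _×-dec_)
open import Relation.Binary using (IsTotalOrder; Decidable)
open import Relation.Binary.PropositionalEquality using (_≡_; _≢_)
import Algebra.Structures as AS
open import Function using (Injective; Surjective)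

-- The real numbers, axiomatised as a (Dedekind-)complete ordered field.
-- Any two such structures are isomorphic, so quantifying over all of them
-- is (classically) the same as speaking about ℝ.

record RealField : Set₁ where
  infixl 6 _+_
  infixl 7 _*_
  infix 4 _≤_
  field
    ℝ        : Set
    _+_ _*_  : ℝ → ℝ → ℝ
    -_       : ℝ → ℝ
    0ℝ 1ℝ    : ℝ
    _≤_      : ℝ → ℝ → Set
    isCommutativeRing : AS.IsCommutativeRing {A = ℝ} _≡_ _+_ _*_ -_ 0ℝ 1ℝ
    0≢1      : 0ℝ ≢ 1ℝ
    inverse  : ∀ x → x ≢ 0ℝ → ∃ λ y → x * y ≡ 1ℝ
    isTotalOrder : IsTotalOrder _≡_ _≤_
    _≤?_     : Decidable _≤_
    +-monoˡ-≤ : ∀ {x y} z → x ≤ y → x + z ≤ y + z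
    *-nonneg  : ∀ {x y} → 0ℝ ≤ x → 0ℝ ≤ y → 0ℝ ≤ x * y
    sup : (P : ℝ → Set) → ∃ P → (∃ λ b → ∀ x → P x → x ≤ b) →
          ∃ λ s → (∀ x → P x → x ≤ s) × (∀ b → (∀ x → P x → x ≤ b) → s ≤ b)

module _ (R : RealField) where
  open RealField R

  record Diversity (n : ℕ) : Set where
    field
      d        : Subset n → ℝ
      nonneg   : ∀ X → 0ℝ ≤ d X
      zero-iff : ∀ X → (d X ≡ 0ℝ → ∣ X ∣ ≤ℕ 1) × (∣ X ∣ ≤ℕ 1 → d X ≡ 0ℝ)
      triangle : ∀ X Y Z → Nonempty Y → d (X ∪ Z) ≤ d (X ∪ Y) + d (Y ∪ Z)

  open Diversity

  image : ∀ {n m} → (Fin n → Fin m) → Subset n → Subset m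
  image f X = tabulate λ y → ⌊ any? (λ x → (x ∈? X) ×-dec (f x ≟ y)) ⌋

  PMap : ℕ → Set
  PMap n = Vec (Maybe (Fin n)) n

  _↦_∈_ : ∀ {n} → Fin n → Fin n → PMap n → Set
  a ↦ b ∈ f = lookup f a ≡ just b

  Dom : ∀ {n} → PMap n → Fin n → Set
  Dom f a = ∃ λ b → a ↦ b ∈ f

  Range : ∀ {n} → PMap n → Fin n → Set
  Range f b = ∃ λ a → a ↦ b ∈ f

  pimage : ∀ {n} → PMap n → Subset n → Subset n
  pimage {n} f X = tabulate λ y →
    ⌊ any? (λ x → (x ∈? X) ×-dec (Data.Maybe.Properties.≡-dec _≟_ (lookup f x) (just y))) ⌋
    where import Data.Maybe.Properties

  _∘ₚ_ : ∀ {n} → PMap n → PMap n → PMap n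
  g ∘ₚ f = tabulate λ a → Data.Maybe._>>=_ (lookup f a) (lookup g)
    where import Data.Maybe

  record IsPartialAut {n} (A : Diversity n) (f : PMap n) : Set where
    field
      injective : ∀ {a a' b} → a ↦ b ∈ f → a' ↦ b ∈ f → a ≡ a'
      preserves : ∀ X → (∀ x → x ∈ X → Dom f x) → d A (pimage f X) ≡ d A X

  record Embedding {n m} (A : Diversity n) (B : Diversity m) : Set where
    field
      map       : Fin n → Fin m
      injective : Injective _≡_ _≡_ map
      preserves : ∀ X → d B (image map X) ≡ d A X

  record Aut {m} (B : Diversity m) : Set where
    field
      map        : Fin m → Fin m
      injective  : Injective _≡_ _≡_ map
      surjective : Surjective _≡_ _≡_ map
      preserves  : ∀ X → d B (image map X) ≡ d B X

  record CoherentEPPAWitness {n m} (A : Diversity n) (B : Diversity m)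
                             (ι : Embedding A B) : Set where
    field
      Ψ : (f : PMap n) → .(IsPartialAut A f) → Aut B
      extends : ∀ f .(pf : IsPartialAut A f) a b → a ↦ b ∈ f →
                Aut.map (Ψ f pf) (Embedding.map ι a) ≡ Embedding.map ι b
      coherent : ∀ f g .(pf : IsPartialAut A f) .(pg : IsPartialAut A g)
                 .(pgf : IsPartialAut A (g ∘ₚ f)) →
                 (∀ b → Dom g b → Range f b) → (∀ b → Range f b → Dom g b) →
                 ∀ x → Aut.map (Ψ (g ∘ₚ f) pgf) x ≡ Aut.map (Ψ g pg) (Aut.map (Ψ f pf) x)

  HasCoherentEPPA : Set
  HasCoherentEPPA = ∀ n (A : Diversity n) →
    Σ ℕ λ m → Σ (Diversity m) λ B → Σ (Embedding A B) λ ι → CoherentEPPAWitness A B ι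

{-# OPTIONS --safe #-}
module Submission where

-- Fix a finite set of decorations ("facts") that a point may carry, and call a decoration c of A closed if it
-- contains the facts that follow from it. Let B consist of the functions I → {sets of facts}, where I is a
-- multiset of closed decorations κ i; a point a of A becomes i ↦ κ i ⟨ a ⟩. A partial automorphism f of A
-- extends to a permutation of the coordinates of B as soon as the restrictions of κ i to Dom f and the pullbacks
-- of κ j along f agree as multisets, and matching them in the order of I makes the extension coherent.
--
-- A fact (W , m) at x says that x is connected to the set W ⊆ A at cost m, and from facts at the points of Z
-- the point x derives their union at the sum of their costs plus d Z, if x ∈ Z. Then the distance of X ⊆ B is
-- the largest defect, over all coordinates, in the inequalities that these derivations impose on the costs.
-- By closedness it is at most d on A, and the decoration "W at cost d (W ∪ {x})" shows that it is at least d.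
--
-- Multiplicities for I come from Möbius inversion: let the total weight of the decorations containing the closed
-- decoration c be k ^ (H - h c). For k large this has a positive solution if h is strictly monotone, and the
-- restrictions to Dom f have an f-invariant distribution if h of the closure of a set of facts on Dom f is
-- f-invariant. The number h counts, with rapidly decreasing weights, the facts of each rank of cost that do not
-- follow from facts of smaller rank, facts that derive each other being counted once.
--
-- Costs are multisets of subsets of A rather than reals: no bound on the length of a chain of small
-- distances reaching a large one can be computed from the axioms for ℝ (the Archimedean property is only
-- available under double negation). Costs are compared by the formal consequences of the inequalities
-- d Y ≤ d Y₁ + d Y₂ that hold in A, for which multiplicities above 2 ^ (2 ^ n) do not matter.

open import Defs
open import Algebra.Bundles using (CommutativeMonoid)
import Algebra.Properties.CommutativeMonoid.Sum
import Algebra.Properties.Monoid.Mult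
import Algebra.Solver.CommutativeMonoid
import Algebra.Structures as AS
open import Data.Bool using (true)
import Data.Bool
import Data.Empty
open import Data.Empty using (⊥-elim)
open import Data.Fin using (Fin; zero; suc; _≟_; toℕ; fromℕ<; _↑ˡ_; _↑ʳ_; splitAt; combine; remQuot; funToFin; finToFun)
import Data.Fin.Properties as Finₚ
open import Data.Fin.Subset using (Subset; _∈_; _⊆_; _∪_; _-_; ∣_∣; Nonempty; ⊤; ⊥; ⁅_⁆)
open import Data.Fin.Subset.Properties
open import Data.Maybe using (just; _>>=_)
import Data.Maybe.Properties as Maybeₚ
open import Data.Nat.Base as ℕ using (ℕ; zero; suc; z≤n; s≤s; _∸_; _⊓_)
  renaming (_+_ to _+ℕ_; _*_ to _*ℕ_; _≤_ to _≤ℕ_; _<_ to _<ℕ_; _^_ to _^ℕ_)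
import Data.Nat.Properties as ℕₚ
open import Data.Nat.Tactic.RingSolver using (solve-∀)
open import Data.Product using (∃; _×_; _,_; proj₁; proj₂)
open import Data.Sum using (_⊎_; inj₁; inj₂; [_,_]′)
import Data.Vec as Vec
open import Data.Vec using (lookup)
import Data.Vec.Properties as Vecₚ
open import Function using (_∘_)
import Relation.Binary
open import Relation.Binary using (IsTotalOrder; Poset) renaming (Decidable to Decidable₂)
open import Relation.Binary.PropositionalEquality using (_≡_; _≢_; refl; sym; trans; cong; cong₂; subst; module ≡-Reasoning)
import Relation.Binary.Reasoning.PartialOrder
open import Relation.Nullary using (¬_; Dec; yes; no)
open import Relation.Nullary.Decidable using (⌊_⌋; _×-dec_; _→-dec_; ¬?; decidable-stable; recompute; toSum)
open import Relation.Unary using () renaming (Decidable to Decidable₁)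
open import Algebra.Properties.CommutativeMonoid.Sum ℕₚ.+-0-commutativeMonoid using (sum; sum-cong-≗; ∑-distrib-+; ∑-comm)
open import Algebra.Properties.Semiring.Sum ℕₚ.+-*-semiring using (*-distribˡ-sum; *-distribʳ-sum)

private variable
  N N′ : ℕ
  P Q : Set

-- Finite sums, counting and positions

𝟙 : Dec P → ℕ
𝟙 (yes _) = 1
𝟙 (no _)  = 0

𝟙-mono : (P? : Dec P) (Q? : Dec Q) → (P → Q) → 𝟙 P? ≤ℕ 𝟙 Q?
𝟙-mono (no _)  _       f = z≤n
𝟙-mono (yes p) (yes q) f = s≤s z≤n
𝟙-mono (yes p) (no ¬q) f = ⊥-elim (¬q (f p))

𝟙-cong : (P? : Dec P) (Q? : Dec Q) → (P → Q) → (Q → P) → 𝟙 P? ≡ 𝟙 Q?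
𝟙-cong P? Q? f g = ℕₚ.≤-antisym (𝟙-mono P? Q? f) (𝟙-mono Q? P? g)

𝟙-true : (P? : Dec P) → P → 𝟙 P? ≡ 1
𝟙-true (yes _) p = refl
𝟙-true (no ¬p) p = ⊥-elim (¬p p)

𝟙-false : (P? : Dec P) → ¬ P → 𝟙 P? ≡ 0
𝟙-false (yes p) ¬p = ⊥-elim (¬p p)
𝟙-false (no _)  ¬p = refl

sum-mono : {f g : Fin N → ℕ} → (∀ i → f i ≤ℕ g i) → sum f ≤ℕ sum g
sum-mono {zero}  h = z≤n
sum-mono {suc N} h = ℕₚ.+-mono-≤ (h zero) (sum-mono (h ∘ suc))

term≤sum : (f : Fin N → ℕ) (i : Fin N) → f i ≤ℕ sum f
term≤sum f zero    = ℕₚ.m≤m+n _ _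
term≤sum f (suc i) = ℕₚ.≤-trans (term≤sum (f ∘ suc) i) (ℕₚ.m≤n+m _ _)

sum-zero : {f : Fin N → ℕ} → (∀ i → f i ≡ 0) → sum f ≡ 0
sum-zero {zero}  h = refl
sum-zero {suc N} h = cong₂ _+ℕ_ (h zero) (sum-zero (h ∘ suc))

sum-const-≤ : {f : Fin N → ℕ} {k : ℕ} → (∀ i → f i ≤ℕ k) → sum f ≤ℕ N *ℕ k
sum-const-≤ {zero}  h = z≤n
sum-const-≤ {suc N} h = ℕₚ.+-mono-≤ (h zero) (sum-const-≤ (h ∘ suc))

sum-delta : (w : Fin N → ℕ) (p : Fin N) → sum (λ q → 𝟙 (p ≟ q) *ℕ w q) ≡ w p
sum-delta w zero = begin
  1 *ℕ w zero +ℕ sum (λ q → 𝟙 (zero ≟ suc q) *ℕ w (suc q))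
    ≡⟨ cong₂ _+ℕ_ (ℕₚ.*-identityˡ _) (sum-zero {f = λ q → 𝟙 (zero ≟ suc q) *ℕ w (suc q)} λ q → refl) ⟩
  w zero +ℕ 0 ≡⟨ ℕₚ.+-identityʳ _ ⟩
  w zero ∎
  where open ≡-Reasoning
sum-delta w (suc p) = trans
  (sum-cong-≗ λ q → cong (_*ℕ w (suc q)) (𝟙-cong (suc p ≟ suc q) (p ≟ q) Finₚ.suc-injective (cong suc)))
  (sum-delta (w ∘ suc) p)

count : {P : Fin N → Set} → Decidable₁ P → ℕ
count P? = sum λ i → 𝟙 (P? i)

count-mono : {P Q : Fin N → Set} (P? : Decidable₁ P) (Q? : Decidable₁ Q) →
             (∀ i → P i → Q i) → count P? ≤ℕ count Q?
count-mono P? Q? h = sum-mono λ i → 𝟙-mono (P? i) (Q? i) (h i)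

count-cong : {P Q : Fin N → Set} (P? : Decidable₁ P) (Q? : Decidable₁ Q) →
             (∀ i → P i → Q i) → (∀ i → Q i → P i) → count P? ≡ count Q?
count-cong P? Q? f g = ℕₚ.≤-antisym (count-mono P? Q? f) (count-mono Q? P? g)

count-≤N : {P : Fin N → Set} (P? : Decidable₁ P) → count P? ≤ℕ N
count-≤N {N} P? = ℕₚ.≤-trans (sum-const-≤ {k = 1} (λ i → le (P? i))) (ℕₚ.≤-reflexive (ℕₚ.*-identityʳ N))
  where
  le : ∀ {P} (d : Dec P) → 𝟙 d ≤ℕ 1
  le (yes _) = s≤s z≤n
  le (no _)  = z≤n

count-mono-< : {P Q : Fin N → Set} (P? : Decidable₁ P) (Q? : Decidable₁ Q) →
               (∀ i → P i → Q i) → ∀ i → Q i → ¬ P i → count P? <ℕ count Q?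
count-mono-< P? Q? h zero q ¬p
  rewrite 𝟙-true (Q? zero) q | 𝟙-false (P? zero) ¬p = s≤s (count-mono (P? ∘ suc) (Q? ∘ suc) (h ∘ suc))
count-mono-< P? Q? h (suc i) q ¬p =
  ℕₚ.+-mono-≤-< (𝟙-mono (P? zero) (Q? zero) (h zero))
                (count-mono-< (P? ∘ suc) (Q? ∘ suc) (h ∘ suc) i q ¬p)

count-unique : {P : Fin N → Set} (P? : Decidable₁ P) → (∀ i j → P i → P j → i ≡ j) → count P? ≤ℕ 1
count-unique {zero}  P? u = z≤n
count-unique {suc N} P? u with P? zero
... | no _  = count-unique (P? ∘ suc) λ i j p q → Finₚ.suc-injective (u _ _ p q)
... | yes p = s≤s (ℕₚ.≤-reflexive (sum-zero λ i → 𝟙-false (P? (suc i)) λ q → 0≢suc (u _ _ p q)))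
  where
  0≢suc : ∀ {n} {i : Fin n} → zero ≢ suc i
  0≢suc ()

-- Double counting of R, which relates every element of P to some element of Q, injectively.
count-≤-by : {P : Fin N → Set} {Q : Fin N′ → Set} {R : Fin N → Fin N′ → Set}
             (P? : Decidable₁ P) (Q? : Decidable₁ Q) (R? : Decidable₂ R) →
             (∀ i → P i → ¬ ¬ ∃ (R i)) → (∀ i j → R i j → Q j) →
             (∀ i i′ j → R i j → R i′ j → i ≡ i′) → count P? ≤ℕ count Q?
count-≤-by {N} {N′} {P} {Q} {R} P? Q? R? total into inj = begin
  count P?                                 ≤⟨ sum-mono left ⟩
  sum (λ i → sum (λ j → 𝟙 (R? i j)))       ≡⟨ ∑-comm (λ i j → 𝟙 (R? i j)) ⟩
  sum (λ j → sum (λ i → 𝟙 (R? i j)))       ≤⟨ sum-mono right ⟩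
  count Q?                                 ∎
  where
  open ℕₚ.≤-Reasoning
  left : ∀ i → 𝟙 (P? i) ≤ℕ sum (λ j → 𝟙 (R? i j))
  left i with P? i
  ... | no _  = z≤n
  ... | yes p with Finₚ.any? (R? i)
  ...   | no ¬r = ⊥-elim (total i p ¬r)
  ...   | yes (j , r) = ℕₚ.≤-trans (ℕₚ.≤-reflexive (sym (𝟙-true (R? i j) r))) (term≤sum _ j)
  right : ∀ j → sum (λ i → 𝟙 (R? i j)) ≤ℕ 𝟙 (Q? j)
  right j with Q? j
  ... | yes _ = count-unique (λ i → R? i j) λ i i′ → inj i i′ j
  ... | no ¬q = ℕₚ.≤-reflexive (sum-zero λ i → 𝟙-false (R? i j) (¬q ∘ into i j))

before : {P : Fin N → Set} → Decidable₁ P → Fin N → ℕ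
before P? zero    = 0
before P? (suc i) = 𝟙 (P? zero) +ℕ before (P? ∘ suc) i

before-cong : {P Q : Fin N → Set} (P? : Decidable₁ P) (Q? : Decidable₁ Q) →
              (∀ i → P i → Q i) → (∀ i → Q i → P i) → ∀ i → before P? i ≡ before Q? i
before-cong P? Q? f g zero    = refl
before-cong P? Q? f g (suc i) = cong₂ _+ℕ_ (𝟙-cong (P? zero) (Q? zero) (f zero) (g zero))
                                           (before-cong (P? ∘ suc) (Q? ∘ suc) (f ∘ suc) (g ∘ suc) i)

before-injective : {P : Fin N → Set} (P? : Decidable₁ P) → ∀ i j → P i → P j →
                   before P? i ≡ before P? j → i ≡ j
before-injective P? zero    zero    p q e = refl
before-injective P? zero    (suc j) p q e rewrite 𝟙-true (P? zero) p with () ← e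
before-injective P? (suc i) zero    p q e rewrite 𝟙-true (P? zero) q with () ← e
before-injective P? (suc i) (suc j) p q e =
  cong suc (before-injective (P? ∘ suc) i j p q (ℕₚ.+-cancelˡ-≡ (𝟙 (P? zero)) _ _ e))

before<count : {P : Fin N → Set} (P? : Decidable₁ P) → ∀ i → P i → before P? i <ℕ count P?
before<count P? zero    p rewrite 𝟙-true (P? zero) p = s≤s z≤n
before<count P? (suc i) p = ℕₚ.+-monoʳ-< (𝟙 (P? zero)) (before<count (P? ∘ suc) i p)

nth : {P : Fin N → Set} (P? : Decidable₁ P) → ∀ k → k <ℕ count P? → ∃ λ i → P i × before P? i ≡ k
nth {zero}  P? k ()
nth {suc N} P? k k< with P? zero in eq
nth {suc N} P? zero    k< | yes p = zero , p , refl
nth {suc N} P? (suc k) k< | yes p with nth (P? ∘ suc) k (ℕₚ.≤-pred k<)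
... | i , q , e = suc i , q , cong₂ _+ℕ_ (cong 𝟙 eq) e
nth {suc N} P? k k< | no ¬p with nth (P? ∘ suc) k k<
... | i , q , e = suc i , q , cong₂ _+ℕ_ (cong 𝟙 eq) e

-- Matching the k-th element of each fibre of one key with the k-th element of the same fibre of another.
-- Being canonical, these matchings compose coherently.
module Matching {M S : ℕ} where

  SameFibres : (k₁ k₂ : Fin M → Fin S) → Set
  SameFibres k₁ k₂ = ∀ s → count (λ i → k₁ i ≟ s) ≡ count (λ i → k₂ i ≟ s)

  abstract
    index : (Fin M → Fin S) → Fin M → ℕ
    index k i = before (λ i′ → k i′ ≟ k i) i

    index-injective : (k : Fin M → Fin S) (i j : Fin M) → k i ≡ k j → index k i ≡ index k j → i ≡ j
    index-injective k i j e ix = before-injective (λ i′ → k i′ ≟ k j) i j e refl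
      (trans (before-cong (λ i′ → k i′ ≟ k j) (λ i′ → k i′ ≟ k i) (λ _ p → trans p (sym e)) (λ _ p → trans p e) i) ix)

    -- An index depends on the partition into fibres and not on the names of the fibres. Coherence
    -- rests on this, since it compares keys that come from different partial maps.
    index-kernel : (k k′ : Fin M → Fin S) → (∀ i j → k i ≡ k j → k′ i ≡ k′ j) → (∀ i j → k′ i ≡ k′ j → k i ≡ k j) →
                   ∀ i → index k i ≡ index k′ i
    index-kernel k k′ f g i = before-cong _ _ (λ i′ → f i′ i) (λ i′ → g i′ i) i

    match′ : (k₁ k₂ : Fin M → Fin S) → SameFibres k₁ k₂ → (j : Fin M) → ∃ λ i → k₁ i ≡ k₂ j × before (λ i′ → k₁ i′ ≟ k₂ j) i ≡ index k₂ j
    match′ k₁ k₂ sf j = nth (λ i → k₁ i ≟ k₂ j) (index k₂ j)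
      (subst (index k₂ j <ℕ_) (sym (sf (k₂ j))) (before<count (λ i → k₂ i ≟ k₂ j) j refl))

    match : (k₁ k₂ : Fin M → Fin S) → SameFibres k₁ k₂ → Fin M → Fin M
    match k₁ k₂ sf j = proj₁ (match′ k₁ k₂ sf j)

    match-key : (k₁ k₂ : Fin M → Fin S) (sf : SameFibres k₁ k₂) (j : Fin M) → k₁ (match k₁ k₂ sf j) ≡ k₂ j
    match-key k₁ k₂ sf j = proj₁ (proj₂ (match′ k₁ k₂ sf j))

    match-index : (k₁ k₂ : Fin M → Fin S) (sf : SameFibres k₁ k₂) (j : Fin M) → index k₁ (match k₁ k₂ sf j) ≡ index k₂ j
    match-index k₁ k₂ sf j = trans
      (before-cong (λ i → k₁ i ≟ k₁ (match k₁ k₂ sf j)) (λ i → k₁ i ≟ k₂ j)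
        (λ i p → trans p (match-key k₁ k₂ sf j)) (λ i p → trans p (sym (match-key k₁ k₂ sf j))) (match k₁ k₂ sf j))
      (proj₂ (proj₂ (match′ k₁ k₂ sf j)))

  match-inverse : (k₁ k₂ : Fin M → Fin S) (sf : SameFibres k₁ k₂) (sf′ : SameFibres k₂ k₁) (j : Fin M) → match k₁ k₂ sf (match k₂ k₁ sf′ j) ≡ j
  match-inverse k₁ k₂ sf sf′ j = index-injective k₁ (match k₁ k₂ sf j′) j
    (trans (match-key k₁ k₂ sf j′) (match-key k₂ k₁ sf′ j))
    (trans (match-index k₁ k₂ sf j′) (match-index k₂ k₁ sf′ j))
    where
    j′ : Fin M
    j′ = match k₂ k₁ sf′ j

-- Möbius inversion over a finite poset
module Möbius {S : ℕ} {_⊑_ : Fin S → Fin S → Set} (_⊑?_ : Decidable₂ _⊑_)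
  (⊑-refl : ∀ p → p ⊑ p)
  (height : Fin S → ℕ) (height-< : ∀ p q → p ⊑ q → p ≢ q → height q <ℕ height p) where

  _⊏_ : Fin S → Fin S → Set
  p ⊏ q = p ⊑ q × p ≢ q

  _⊏?_ : Decidable₂ _⊏_
  p ⊏? q = (p ⊑? q) ×-dec ¬? (p ≟ q)

  up : (Fin S → ℕ) → Fin S → ℕ
  up m p = sum λ q → 𝟙 (p ⊑? q) *ℕ m q

  above : (Fin S → ℕ) → Fin S → ℕ
  above m p = sum λ q → 𝟙 (p ⊏? q) *ℕ m q

  up-split : ∀ m p → up m p ≡ m p +ℕ above m p
  up-split m p = begin
    up m p ≡⟨ sum-cong-≗ pointwise ⟩
    sum (λ q → 𝟙 (p ≟ q) *ℕ m q +ℕ 𝟙 (p ⊏? q) *ℕ m q)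
      ≡⟨ ∑-distrib-+ (λ q → 𝟙 (p ≟ q) *ℕ m q) (λ q → 𝟙 (p ⊏? q) *ℕ m q) ⟩
    sum (λ q → 𝟙 (p ≟ q) *ℕ m q) +ℕ above m p ≡⟨ cong (_+ℕ above m p) (sum-delta m p) ⟩
    m p +ℕ above m p ∎
    where
    open ≡-Reasoning
    pointwise : ∀ q → 𝟙 (p ⊑? q) *ℕ m q ≡ 𝟙 (p ≟ q) *ℕ m q +ℕ 𝟙 (p ⊏? q) *ℕ m q
    pointwise q with p ⊑? q | p ≟ q
    ... | yes _ | yes _ = sym (ℕₚ.+-identityʳ _)
    ... | yes _ | no _  = refl
    ... | no _  | no _  = refl
    ... | no n  | yes refl = ⊥-elim (n (⊑-refl p))

  above-cong : ∀ {m m′} p → (∀ q → height q <ℕ height p → m q ≡ m′ q) → above m p ≡ above m′ p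
  above-cong {m} {m′} p h = sum-cong-≗ λ q → pointwise q
    where
    pointwise : ∀ q → 𝟙 (p ⊏? q) *ℕ m q ≡ 𝟙 (p ⊏? q) *ℕ m′ q
    pointwise q with p ⊏? q
    ... | no _ = refl
    ... | yes (p⊑q , p≢q) = cong (1 *ℕ_) (h q (height-< p q p⊑q p≢q))

  -- The equation `up m p ≡ m p +ℕ above m p` determines `m p` from the values strictly above `p`,
  -- which have smaller height.
  up-injective : ∀ {m m′} → (∀ p → up m p ≡ up m′ p) → ∀ p → m p ≡ m′ p
  up-injective {m} {m′} e p = go _ p ℕₚ.≤-refl
    where
    go : ∀ k p → height p <ℕ k → m p ≡ m′ p
    go (suc k) p h< = ℕₚ.+-cancelʳ-≡ (above m p) _ _ (begin
      m p +ℕ above m p    ≡⟨ up-split m p ⟨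
      up m p              ≡⟨ e p ⟩
      up m′ p             ≡⟨ up-split m′ p ⟩
      m′ p +ℕ above m′ p  ≡⟨ cong (m′ p +ℕ_) (above-cong p λ q q< → go k q (ℕₚ.≤-trans q< (ℕₚ.≤-pred h<))) ⟨
      m′ p +ℕ above m p   ∎)
      where open ≡-Reasoning

  module Inversion {P : Fin S → Set} (P? : Decidable₁ P) (n : Fin S → ℕ) where

    restricted : Fin S → ℕ
    restricted p = 𝟙 (P? p) *ℕ n p

    -- The first argument is fuel, enough once it exceeds the height. The subtraction is truncated;
    -- `up-weight` says when it is exact.
    weight′ : ℕ → Fin S → ℕ
    weight′ zero    p = 0
    weight′ (suc k) p = 𝟙 (P? p) *ℕ (n p ∸ above (weight′ k) p)

    weight′-stable : ∀ k k′ p → height p <ℕ k → height p <ℕ k′ → weight′ k p ≡ weight′ k′ p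
    weight′-stable (suc k) (suc k′) p (s≤s h) (s≤s h′) = cong (λ a → 𝟙 (P? p) *ℕ (n p ∸ a))
      (above-cong p λ q q< → weight′-stable k k′ q (ℕₚ.≤-trans q< h) (ℕₚ.≤-trans q< h′))

    weight : Fin S → ℕ
    weight p = weight′ (suc (height p)) p

    weight-unfold : ∀ p → weight p ≡ 𝟙 (P? p) *ℕ (n p ∸ above weight p)
    weight-unfold p = cong (λ a → 𝟙 (P? p) *ℕ (n p ∸ a))
      (above-cong p λ q q< → weight′-stable _ _ q q< ℕₚ.≤-refl)

    weight≤ : ∀ p → weight p ≤ℕ restricted p
    weight≤ p = ℕₚ.≤-trans (ℕₚ.≤-reflexive (weight-unfold p)) (ℕₚ.*-monoʳ-≤ (𝟙 (P? p)) (ℕₚ.m∸n≤m (n p) (above weight p)))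

    above-weight≤ : ∀ p → above weight p ≤ℕ above restricted p
    above-weight≤ p = sum-mono λ q → ℕₚ.*-monoʳ-≤ (𝟙 (p ⊏? q)) (weight≤ q)

    weight-outside : ∀ p → ¬ P p → weight p ≡ 0
    weight-outside p ¬p = trans (weight-unfold p) (cong (_*ℕ (n p ∸ above weight p)) (𝟙-false (P? p) ¬p))

    weight-inside : ∀ p → P p → weight p ≡ n p ∸ above weight p
    weight-inside p Pp = trans (weight-unfold p) (trans (cong (_*ℕ (n p ∸ above weight p)) (𝟙-true (P? p) Pp)) (ℕₚ.*-identityˡ _))

    -- No weight exceeds its `restricted` value, so the bound on `above restricted` keeps the
    -- subtraction from truncating.
    up-weight : ∀ p → P p → above restricted p ≤ℕ n p → up weight p ≡ n p
    up-weight p Pp le = trans (up-split weight p) (trans (cong (_+ℕ above weight p) (weight-inside p Pp))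
      (ℕₚ.m∸n+n≡m (ℕₚ.≤-trans (above-weight≤ p) le)))

    weight-positive : ∀ p → P p → above restricted p <ℕ n p → 0 <ℕ weight p
    weight-positive p Pp lt = subst (0 <ℕ_) (sym (weight-inside p Pp))
      (ℕₚ.m<n⇒0<n∸m (ℕₚ.≤-<-trans (above-weight≤ p) lt))

  pushforward : ∀ {C} → (Fin C → ℕ) → (Fin C → Fin S) → Fin S → ℕ
  pushforward w r p = sum λ c → 𝟙 (p ≟ r c) *ℕ w c

  up-pushforward : ∀ {C} (w : Fin C → ℕ) (r : Fin C → Fin S) p →
                   up (pushforward w r) p ≡ sum λ c → 𝟙 (p ⊑? r c) *ℕ w c
  up-pushforward w r p = begin
    sum (λ q → 𝟙 (p ⊑? q) *ℕ sum (λ c → 𝟙 (q ≟ r c) *ℕ w c))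
      ≡⟨ sum-cong-≗ (λ q → *-distribˡ-sum (𝟙 (p ⊑? q)) (λ c → 𝟙 (q ≟ r c) *ℕ w c)) ⟩
    sum (λ q → sum (λ c → 𝟙 (p ⊑? q) *ℕ (𝟙 (q ≟ r c) *ℕ w c)))
      ≡⟨ ∑-comm (λ q c → 𝟙 (p ⊑? q) *ℕ (𝟙 (q ≟ r c) *ℕ w c)) ⟩
    sum (λ c → sum (λ q → 𝟙 (p ⊑? q) *ℕ (𝟙 (q ≟ r c) *ℕ w c)))
      ≡⟨ sum-cong-≗ (λ c → trans (sum-cong-≗ λ q → reorder q c) (sum-delta (λ q → 𝟙 (p ⊑? q) *ℕ w c) (r c))) ⟩
    sum (λ c → 𝟙 (p ⊑? r c) *ℕ w c) ∎
    where
    open ≡-Reasoning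
    swap : ∀ a b c → a *ℕ (b *ℕ c) ≡ b *ℕ (a *ℕ c)
    swap a b c = trans (sym (ℕₚ.*-assoc a b c)) (trans (cong (_*ℕ c) (ℕₚ.*-comm a b)) (ℕₚ.*-assoc b a c))
    reorder : ∀ q c → 𝟙 (p ⊑? q) *ℕ (𝟙 (q ≟ r c) *ℕ w c) ≡ 𝟙 (r c ≟ q) *ℕ (𝟙 (p ⊑? q) *ℕ w c)
    reorder q c = trans (cong (λ z → 𝟙 (p ⊑? q) *ℕ (z *ℕ w c)) (𝟙-cong (q ≟ r c) (r c ≟ q) sym sym))
      (swap (𝟙 (p ⊑? q)) (𝟙 (r c ≟ q)) (w c))

  -- By `up-injective`, two distributions agree as soon as they give the same mass to every
  -- principal upper set.
  pushforward-≡ : ∀ {C} (w : Fin C → ℕ) (r r′ : Fin C → Fin S) →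
    (∀ p → sum (λ c → 𝟙 (p ⊑? r c) *ℕ w c) ≡ sum (λ c → 𝟙 (p ⊑? r′ c) *ℕ w c)) →
    ∀ p → pushforward w r p ≡ pushforward w r′ p
  pushforward-≡ w r r′ e = up-injective λ p →
    trans (up-pushforward w r p) (trans (e p) (sym (up-pushforward w r′ p)))

-- Listing a multiset given by multiplicities

sum-++ : ∀ a {b} (f : Fin (a +ℕ b) → ℕ) → sum f ≡ sum (λ i → f (i ↑ˡ b)) +ℕ sum (λ j → f (a ↑ʳ j))
sum-++ zero    f = refl
sum-++ (suc a) f = trans (cong (f zero +ℕ_) (sum-++ a (f ∘ suc))) (sym (ℕₚ.+-assoc (f zero) _ _))

sum-const : ∀ a k → sum {a} (λ _ → k) ≡ k *ℕ a
sum-const zero    k = sym (ℕₚ.*-zeroʳ k)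
sum-const (suc a) k = trans (cong (k +ℕ_) (sum-const a k)) (sym (ℕₚ.*-suc k a))

enumerate : ∀ {S} (w : Fin S → ℕ) → Fin (sum w) → Fin S
enumerate {suc S} w i = [ (λ _ → zero) , suc ∘ enumerate (w ∘ suc) ]′ (splitAt (w zero) i)

count-enumerate : ∀ {S} (w : Fin S → ℕ) {P : Fin S → Set} (P? : Decidable₁ P) →
                  count (λ i → P? (enumerate w i)) ≡ sum λ c → 𝟙 (P? c) *ℕ w c
count-enumerate {zero}  w P? = refl
count-enumerate {suc S} w P? = trans (sum-++ (w zero) (λ i → 𝟙 (P? (enumerate w i)))) (cong₂ _+ℕ_
  (trans (sum-cong-≗ λ i → cong (𝟙 ∘ P? ∘ [ (λ _ → zero) , suc ∘ enumerate (w ∘ suc) ]′) (Finₚ.splitAt-↑ˡ (w zero) i _))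
         (sum-const (w zero) (𝟙 (P? zero))))
  (trans (sum-cong-≗ λ j → cong (𝟙 ∘ P? ∘ [ (λ _ → zero) , suc ∘ enumerate (w ∘ suc) ]′) (Finₚ.splitAt-↑ʳ (w zero) _ j))
         (count-enumerate (w ∘ suc) (P? ∘ suc))))

enumerate-surjective : ∀ {S} (w : Fin S → ℕ) c → 0 <ℕ w c → ∃ λ i → enumerate w i ≡ c
enumerate-surjective {suc S} w zero 0< with w zero
... | suc k = zero , refl
enumerate-surjective {suc S} w (suc c) 0< with enumerate-surjective (w ∘ suc) c 0<
... | i , e = w zero ↑ʳ i , trans (cong [ (λ _ → zero) , suc ∘ enumerate (w ∘ suc) ]′ (Finₚ.splitAt-↑ʳ (w zero) _ i)) (cong suc e)

enumerate-positive : ∀ {S} (w : Fin S → ℕ) i → 0 <ℕ w (enumerate w i)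
enumerate-positive {suc S} w i with splitAt (w zero) i
... | inj₁ j = ℕₚ.≤-<-trans z≤n (Finₚ.toℕ<n j)
... | inj₂ j = enumerate-positive (w ∘ suc) j

-- Real arithmetic, weak excluded middle and infima

module RealLemmas (R : RealField) where
  open RealField R public hiding (_*_; inverse)
  open AS.IsCommutativeRing isCommutativeRing public
    using (+-assoc; +-comm; +-identityˡ; +-identityʳ; -‿inverseˡ; -‿inverseʳ; +-isCommutativeMonoid)
  open IsTotalOrder isTotalOrder public
    renaming (refl to ≤-refl; reflexive to ≤-reflexive; trans to ≤-trans; antisym to ≤-antisym; total to ≤-total)
    using (isPartialOrder)

  ≤-poset : Poset _ _ _
  ≤-poset = record { isPartialOrder = isPartialOrder }

  module ≤-Reasoning = Relation.Binary.Reasoning.PartialOrder ≤-poset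

  +-commutativeMonoid : CommutativeMonoid _ _
  +-commutativeMonoid = record { isCommutativeMonoid = +-isCommutativeMonoid }

  module ℝSum = Algebra.Properties.CommutativeMonoid.Sum +-commutativeMonoid
  open Algebra.Properties.Monoid.Mult (CommutativeMonoid.monoid +-commutativeMonoid) using (×-homo-+) renaming (_×_ to _×ℝ_)

  +-rearrange : ∀ a b c e → (a + b) + (c + e) ≡ (c + a) + (e + b)
  +-rearrange = solve 4 (λ a b c e → (a ⊕ b) ⊕ (c ⊕ e) ⊜ (c ⊕ a) ⊕ (e ⊕ b)) refl
    where open Algebra.Solver.CommutativeMonoid +-commutativeMonoid

  +-swap : ∀ a b c → a + (b + c) ≡ b + (a + c)
  +-swap = solve 3 (λ a b c → a ⊕ (b ⊕ c) ⊜ b ⊕ (a ⊕ c)) refl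
    where open Algebra.Solver.CommutativeMonoid +-commutativeMonoid

  ≤-stable : ∀ {x y} → ¬ ¬ x ≤ y → x ≤ y
  ≤-stable {x} {y} ¬¬p with x ≤? y
  ... | yes p = p
  ... | no ¬p = ⊥-elim (¬¬p ¬p)

  _≟ℝ_ : ∀ x y → Dec (x ≡ y)
  x ≟ℝ y with x ≤? y | y ≤? x
  ... | yes p | yes q = yes (≤-antisym p q)
  ... | no ¬p | _     = no λ { refl → ¬p ≤-refl }
  ... | yes _ | no ¬q = no λ { refl → ¬q ≤-refl }

  +-mono-≤ : ∀ {x y u v} → x ≤ y → u ≤ v → x + u ≤ y + v
  +-mono-≤ {x} {y} {u} {v} p q = begin
    x + u ≤⟨ +-monoˡ-≤ u p ⟩
    y + u ≡⟨ +-comm y u ⟩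
    u + y ≤⟨ +-monoˡ-≤ y q ⟩
    v + y ≡⟨ +-comm v y ⟩
    y + v ∎
    where open ≤-Reasoning

  +-cancelʳ : ∀ x y → (x + y) + (- y) ≡ x
  +-cancelʳ x y = trans (+-assoc x y (- y)) (trans (cong (x +_) (-‿inverseʳ y)) (+-identityʳ x))

  -+-cancelʳ : ∀ x y → (x + (- y)) + y ≡ x
  -+-cancelʳ x y = trans (+-assoc x (- y) y) (trans (cong (x +_) (-‿inverseˡ y)) (+-identityʳ x))

  ≤+⇒-≤ : ∀ {x y z} → x ≤ y + z → x + (- z) ≤ y
  ≤+⇒-≤ {x} {y} {z} p = subst (x + (- z) ≤_) (+-cancelʳ y z) (+-monoˡ-≤ (- z) p)

  -≤⇒≤+ : ∀ {x y z} → x + (- z) ≤ y → x ≤ y + z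
  -≤⇒≤+ {x} {y} {z} p = subst (_≤ y + z) (-+-cancelʳ x z) (+-monoˡ-≤ z p)

  x≤y+x : ∀ {x y} → 0ℝ ≤ y → x ≤ y + x
  x≤y+x {x} {y} p = subst (_≤ y + x) (+-identityˡ x) (+-monoˡ-≤ x p)

  x≤x+y : ∀ {x y} → 0ℝ ≤ y → x ≤ x + y
  x≤x+y {x} {y} p = subst (x ≤_) (+-comm y x) (x≤y+x p)

  0≤+ : ∀ {x y} → 0ℝ ≤ x → 0ℝ ≤ y → 0ℝ ≤ x + y
  0≤+ p q = ≤-trans p (x≤x+y q)

  abstract
    positive : ∃ λ u → 0ℝ ≤ u × u ≢ 0ℝ
    positive with ≤-total 0ℝ 1ℝ
    ... | inj₁ 0≤1 = 1ℝ , 0≤1 , (0≢1 ∘ sym)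
    ... | inj₂ 1≤0 = - 1ℝ
                   , subst (_≤ - 1ℝ) (-‿inverseʳ 1ℝ) (subst (1ℝ + (- 1ℝ) ≤_) (+-identityˡ _) (+-monoˡ-≤ (- 1ℝ) 1≤0))
                   , λ e → 0≢1 (trans (sym (-‿inverseʳ 1ℝ)) (trans (cong (1ℝ +_) e) (+-identityʳ 1ℝ)))

    -- Weak excluded middle: compare with 0 the supremum of {0} ∪ {u ∣ Q}, where u > 0.
    dec¬ : (Q : Set) → Dec (¬ Q)
    dec¬ Q with positive
    ... | u , 0≤u , u≢0 with sup (λ x → x ≡ 0ℝ ⊎ (x ≡ u × Q)) (0ℝ , inj₁ refl)
                               (u , λ { x (inj₁ refl) → 0≤u ; x (inj₂ (refl , _)) → ≤-refl })
    ...   | s , upper , least with s ≤? 0ℝ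
    ...     | yes s≤0 = yes λ q → u≢0 (≤-antisym (≤-trans (upper u (inj₂ (refl , q))) s≤0) 0≤u)
    ...     | no  s≰0 = no λ ¬q → s≰0 (least 0ℝ λ { x (inj₁ refl) → ≤-refl ; x (inj₂ (_ , q)) → ⊥-elim (¬q q) })

  Supremum Infimum : (ℝ → Set) → Set
  Supremum P = ∃ λ s → (∀ x → P x → x ≤ s) × (∀ b → (∀ x → P x → x ≤ b) → s ≤ b)
  Infimum  P = ∃ λ s → (∀ x → P x → s ≤ x) × (∀ b → (∀ x → P x → b ≤ x) → b ≤ s)

  infimum : (P : ℝ → Set) → ∃ P → (∃ λ b → ∀ x → P x → b ≤ x) → Infimum P
  infimum P (a , Pa) (b , b≤) with sup (λ y → ∀ x → P x → y ≤ x) (b , b≤) (a , λ y y≤ → y≤ a Pa)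
  ... | s , upper , least = s , (λ x Px → least x λ y y≤ → y≤ x Px) , upper

  positive-lower-bound : ∀ {n} (f : Fin n → ℝ) → (∀ i → 0ℝ ≤ f i) → (∀ i → f i ≢ 0ℝ) →
                         ∃ λ u → 0ℝ ≤ u × u ≢ 0ℝ × (∀ i → u ≤ f i)
  positive-lower-bound {zero} f f≥0 f≢0 with positive
  ... | u , p , q = u , p , q , λ ()
  positive-lower-bound {suc n} f f≥0 f≢0 with positive-lower-bound (f ∘ suc) (f≥0 ∘ suc) (f≢0 ∘ suc)
  ... | u , p , q , r with ≤-total (f zero) u
  ...   | inj₁ s = f zero , f≥0 zero , f≢0 zero , λ { zero → ≤-refl ; (suc i) → ≤-trans s (r i) }
  ...   | inj₂ s = u , p , q , λ { zero → s ; (suc i) → r i }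

  module Total {l : ℕ} (val : Fin l → ℝ) (val≥0 : ∀ i → 0ℝ ≤ val i) where

    private
      ×-nonneg : ∀ k {x} → 0ℝ ≤ x → 0ℝ ≤ k ×ℝ x
      ×-nonneg zero    p = ≤-refl
      ×-nonneg (suc k) p = 0≤+ p (×-nonneg k p)

      sum-nonneg : ∀ {k} (f : Fin k → ℝ) → (∀ i → 0ℝ ≤ f i) → 0ℝ ≤ ℝSum.sum f
      sum-nonneg {zero}  f p = ≤-refl
      sum-nonneg {suc k} f p = 0≤+ (p zero) (sum-nonneg (f ∘ suc) (p ∘ suc))

      term≤ : ∀ {k} (f : Fin k → ℝ) → (∀ i → 0ℝ ≤ f i) → ∀ i → f i ≤ ℝSum.sum f
      term≤ f p zero    = x≤x+y (sum-nonneg (f ∘ suc) (p ∘ suc))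
      term≤ f p (suc i) = ≤-trans (term≤ (f ∘ suc) (p ∘ suc) i) (x≤y+x (p zero))

      sum-unit : ∀ {k} (f : Fin k → ℝ) i → ℝSum.sum (λ j → 𝟙 (i ≟ j) ×ℝ f j) ≡ f i
      sum-unit {suc k} f zero = trans
        (cong₂ _+_ (+-identityʳ (f zero)) (ℝSum.sum-replicate-zero k)) (+-identityʳ (f zero))
      sum-unit {suc k} f (suc i) = trans (+-identityˡ _) (trans
        (ℝSum.sum-cong-≗ λ j → cong (_×ℝ f (suc j)) (𝟙-cong (suc i ≟ suc j) (i ≟ j) Finₚ.suc-injective (cong suc)))
        (sum-unit (f ∘ suc) i))

    total : (Fin l → ℕ) → ℝ
    total m = ℝSum.sum λ i → m i ×ℝ val i

    total-nonneg : ∀ m → 0ℝ ≤ total m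
    total-nonneg m = sum-nonneg _ λ i → ×-nonneg (m i) (val≥0 i)

    total-zero : total (λ _ → 0) ≡ 0ℝ
    total-zero = ℝSum.sum-replicate-zero l

    total-+ : ∀ m m′ → total (λ i → m i +ℕ m′ i) ≡ total m + total m′
    total-+ m m′ = trans (ℝSum.sum-cong-≗ λ i → ×-homo-+ (val i) (m i) (m′ i))
                         (ℝSum.∑-distrib-+ (λ i → m i ×ℝ val i) (λ i → m′ i ×ℝ val i))

    total-mono : ∀ {m m′} → (∀ i → m i ≤ℕ m′ i) → total m ≤ total m′
    total-mono {m} {m′} p = begin
      total m                              ≤⟨ x≤x+y (total-nonneg (λ i → m′ i ∸ m i)) ⟩
      total m + total (λ i → m′ i ∸ m i)   ≡⟨ total-+ m _ ⟨
      total (λ i → m i +ℕ (m′ i ∸ m i))    ≡⟨ ℝSum.sum-cong-≗ (λ i → cong (_×ℝ val i) (ℕₚ.m+[n∸m]≡n (p i))) ⟩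
      total m′                             ∎
      where open ≤-Reasoning

    total-unit : ∀ i → total (λ j → 𝟙 (i ≟ j)) ≡ val i
    total-unit i = sum-unit val i

    val≤total : ∀ m i → 1 ≤ℕ m i → val i ≤ total m
    val≤total m i p = ≤-trans (le (m i) p) (term≤ (λ j → m j ×ℝ val j) (λ j → ×-nonneg (m j) (val≥0 j)) i)
      where
      le : ∀ k → 1 ≤ℕ k → val i ≤ k ×ℝ val i
      le (suc k) _ = x≤x+y (×-nonneg k (val≥0 i))

-- Formal costs and covering trees

module Costs (R : RealField) {l : ℕ} (val : Fin l → RealField.ℝ R)
             (val≥0 : ∀ i → RealField._≤_ R (RealField.0ℝ R) (val i)) where
  open RealLemmas R
  open Total val val≥0

  Cost : Set
  Cost = Fin l → ℕ

  infixl 6 _⊕_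
  _⊕_ : Cost → Cost → Cost
  (m ⊕ m′) i = m i +ℕ m′ i

  𝟘 : Cost
  𝟘 _ = 0

  unit : Fin l → Cost
  unit i j = 𝟙 (i ≟ j)

  infix 4 _≤̇_
  _≤̇_ : Cost → Cost → Set
  m ≤̇ m′ = ∀ i → m i ≤ℕ m′ i

  -- The inequality val y ≤ total m follows formally, by a tree whose leaves fit into m,
  -- from the inequalities between one value and a sum of two values.
  data Covers : Fin l → Cost → Set where
    free : ∀ {y m} → val y ≤ 0ℝ → Covers y m
    leaf : ∀ {y m} i → val y ≤ val i → 1 ≤ℕ m i → Covers y m
    node : ∀ {y y₁ y₂ m m₁ m₂} → val y ≤ val y₁ + val y₂ →
           Covers y₁ m₁ → Covers y₂ m₂ → m₁ ⊕ m₂ ≤̇ m → Covers y m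

  covers-mono : ∀ {y m m′} → m ≤̇ m′ → Covers y m → Covers y m′
  covers-mono p (free q)         = free q
  covers-mono p (leaf i q r)     = leaf i q (ℕₚ.≤-trans r (p i))
  covers-mono p (node q c c′ r)  = node q c c′ λ i → ℕₚ.≤-trans (r i) (p i)

  covers-val : ∀ {y y′ m} → val y ≤ val y′ → Covers y′ m → Covers y m
  covers-val p (free q)        = free (≤-trans p q)
  covers-val p (leaf i q r)    = leaf i (≤-trans p q) r
  covers-val p (node q c c′ r) = node (≤-trans p q) c c′ r

  covers-sound : ∀ {y m} → Covers y m → val y ≤ total m
  covers-sound {m = m} (free p)     = ≤-trans p (total-nonneg m)
  covers-sound {m = m} (leaf i p q) = ≤-trans p (val≤total m i q)
  covers-sound {m = m} (node {m₁ = m₁} {m₂ = m₂} p c c′ r) =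
    ≤-trans p (≤-trans (+-mono-≤ (covers-sound c) (covers-sound c′))
      (≤-trans (≤-reflexive (sym (total-+ m₁ m₂))) (total-mono r)))

  -- Cut elimination: the tree for `y` is grafted onto a leaf `y` of the tree for `y₀`. The one copy
  -- of `y` that is replaced by `r` can be charged to a single branch at each node, so the grafting
  -- follows one path.
  covers-subst : ∀ {y y₀ r m z} → Covers y r → Covers y₀ m → m ≤̇ unit y ⊕ z → Covers y₀ (r ⊕ z)
  covers-subst d (free p) q = free p
  covers-subst {y} {y₀} {r} {m} {z} d (leaf i p 1≤) q with y ≟ i | q i
  ... | yes refl | _  = covers-mono (λ j → ℕₚ.m≤m+n (r j) (z j)) (covers-val p d)
  ... | no _     | qi = leaf i p (ℕₚ.≤-trans 1≤ (ℕₚ.≤-trans qi (ℕₚ.m≤n+m (z i) (r i))))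
  covers-subst {y} {y₀} {r} {m} {z} d (node {m₁ = m₁} {m₂ = m₂} p c c′ s) q with m₁ y in eq
  ... | zero = node p c (covers-subst {z = λ i → m₂ i ∸ unit y i} d c′ in₂) fit
    where
    in₂ : m₂ ≤̇ unit y ⊕ (λ i → m₂ i ∸ unit y i)
    in₂ i = ℕₚ.m≤n+m∸n (m₂ i) (unit y i)
    fit : m₁ ⊕ (r ⊕ (λ i → m₂ i ∸ unit y i)) ≤̇ r ⊕ z
    fit i = subst (_≤ℕ r i +ℕ z i) (lem (m₁ i) (r i) (m₂ i ∸ unit y i)) (ℕₚ.+-monoʳ-≤ (r i) (rest i))
      where
      lem : ∀ a b c → b +ℕ (a +ℕ c) ≡ a +ℕ (b +ℕ c)
      lem = solve-∀
      rest : ∀ i → m₁ i +ℕ (m₂ i ∸ unit y i) ≤ℕ z i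
      rest i with y ≟ i | ℕₚ.≤-trans (s i) (q i)
      ... | no _     | h = h
      ... | yes refl | h rewrite eq = ℕₚ.m≤n+o⇒m∸n≤o (m₂ y) 1 h
  ... | suc k = node p (covers-subst {z = λ i → m₁ i ∸ unit y i} d c in₁) c′ fit
    where
    in₁ : m₁ ≤̇ unit y ⊕ (λ i → m₁ i ∸ unit y i)
    in₁ i = ℕₚ.m≤n+m∸n (m₁ i) (unit y i)
    fit : (r ⊕ (λ i → m₁ i ∸ unit y i)) ⊕ m₂ ≤̇ r ⊕ z
    fit i = subst (_≤ℕ r i +ℕ z i) (sym (ℕₚ.+-assoc (r i) (m₁ i ∸ unit y i) (m₂ i))) (ℕₚ.+-monoʳ-≤ (r i) (rest i))
      where
      rest : ∀ i → (m₁ i ∸ unit y i) +ℕ m₂ i ≤ℕ z i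
      rest i with y ≟ i | ℕₚ.≤-trans (s i) (q i)
      ... | no _     | h = h
      ... | yes refl | h rewrite eq = ℕₚ.≤-pred h

  -- Covering trees whose inner labels lie in V and do not repeat along a branch.
  data LoopFree : Subset l → Fin l → Cost → Set where
    free : ∀ {V y m} → val y ≤ 0ℝ → LoopFree V y m
    leaf : ∀ {V y m} i → val y ≤ val i → 1 ≤ℕ m i → LoopFree V y m
    node : ∀ {V y y₁ y₂ m m₁ m₂} → y ∈ V → val y ≤ val y₁ + val y₂ →
           LoopFree (V - y) y₁ m₁ → LoopFree (V - y) y₂ m₂ → m₁ ⊕ m₂ ≤̇ m → LoopFree V y m

  ∈-minus : ∀ (V : Subset l) {x y} → x ∈ V - y → x ∈ V × x ≢ y
  ∈-minus V {x} {y} p = p─q⊆p V ⁅ y ⁆ p , λ { refl → ℕₚ.<-irrefl refl (lem V x p) }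
    where
    lem : ∀ {n} (V : Subset n) x → x ∈ V - x → 1 <ℕ 1
    lem (_ Vec.∷ V) zero ()
    lem (_ Vec.∷ V) (suc x) (Vec.there p) = lem V x p

  minus-mono : ∀ {V V′ : Subset l} {y} → V ⊆ V′ → V - y ⊆ V′ - y
  minus-mono {V} {V′} {y} p q with ∈-minus V q
  ... | q∈V , q≢y = x∈p∧x≢y⇒x∈p-y (p q∈V) q≢y

  minus-swap : ∀ (V : Subset l) {y y′} → V - y - y′ ⊆ V - y′ - y
  minus-swap V {y} {y′} p = subst (_ ∈_) (p─x─y≡p─y─x V y y′) p

  loopFree-mono : ∀ {V V′ y m m′} → V ⊆ V′ → m ≤̇ m′ → LoopFree V y m → LoopFree V′ y m′
  loopFree-mono V⊆ p (free q) = free q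
  loopFree-mono V⊆ p (leaf i q r) = leaf i q (ℕₚ.≤-trans r (p i))
  loopFree-mono V⊆ p (node y∈ q c c′ r) = node (V⊆ y∈) q
    (loopFree-mono (minus-mono V⊆) (λ _ → ℕₚ.≤-refl) c) (loopFree-mono (minus-mono V⊆) (λ _ → ℕₚ.≤-refl) c′)
    λ i → ℕₚ.≤-trans (r i) (p i)

  find-loop : ∀ {V y m} y′ → LoopFree V y m → LoopFree (V - y′) y m ⊎ LoopFree V y′ m
  find-loop y′ (free p) = inj₁ (free p)
  find-loop y′ (leaf i p q) = inj₁ (leaf i p q)
  find-loop {V} {y} y′ t@(node {m₁ = m₁} {m₂ = m₂} y∈ p c c′ r) with y ≟ y′
  ... | yes refl = inj₂ t
  ... | no y≢ with find-loop y′ c | find-loop y′ c′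
  ...   | inj₂ u | _ = inj₂ (loopFree-mono (p─q⊆p V ⁅ y ⁆) (λ i → ℕₚ.≤-trans (ℕₚ.m≤m+n (m₁ i) (m₂ i)) (r i)) u)
  ...   | inj₁ _ | inj₂ u = inj₂ (loopFree-mono (p─q⊆p V ⁅ y ⁆) (λ i → ℕₚ.≤-trans (ℕₚ.m≤n+m (m₂ i) (m₁ i)) (r i)) u)
  ...   | inj₁ u | inj₁ u′ = inj₁ (node (x∈p∧x≢y⇒x∈p-y y∈ y≢) p
            (loopFree-mono (minus-swap V) (λ _ → ℕₚ.≤-refl) u) (loopFree-mono (minus-swap V) (λ _ → ℕₚ.≤-refl) u′) r)

  -- If the label of the root occurs again below, the subtree found there replaces the whole tree.
  covers⇒loopFree : ∀ {y m} → Covers y m → LoopFree ⊤ y m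
  covers⇒loopFree (free p) = free p
  covers⇒loopFree (leaf i p q) = leaf i p q
  covers⇒loopFree {y} (node {m₁ = m₁} {m₂ = m₂} p c c′ r)
    with find-loop y (covers⇒loopFree c) | find-loop y (covers⇒loopFree c′)
  ... | inj₁ u | inj₁ u′ = node ∈⊤ p u u′ r
  ... | inj₂ u | _       = loopFree-mono ⊆-refl (λ i → ℕₚ.≤-trans (ℕₚ.m≤m+n (m₁ i) (m₂ i)) (r i)) u
  ... | inj₁ _ | inj₂ u  = loopFree-mono ⊆-refl (λ i → ℕₚ.≤-trans (ℕₚ.m≤n+m (m₂ i) (m₁ i)) (r i)) u

  -- Labels do not repeat along a branch, so the depth is at most `k` and the tree has at most
  -- `2 ^ℕ k` leaves.
  loopFree⇒covers : ∀ {V y m} k → ∣ V ∣ ≤ℕ k → LoopFree V y m → Covers y (λ i → m i ⊓ (2 ^ℕ k))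
  loopFree⇒covers k V≤ (free p) = free p
  loopFree⇒covers k V≤ (leaf i p q) = leaf i p (ℕₚ.⊓-glb q (ℕₚ.m^n>0 2 k))
  loopFree⇒covers zero V≤ (node y∈ p c c′ r) with () ← ℕₚ.<-≤-trans (x∈p⇒∣p-x∣<∣p∣ y∈) V≤
  loopFree⇒covers {V} {y} {m} (suc k) V≤ (node {m₁ = m₁} {m₂ = m₂} y∈ p c c′ r) =
    node p (loopFree⇒covers k V-y≤ c) (loopFree⇒covers k V-y≤ c′) fit
    where
    V-y≤ : ∣ V - y ∣ ≤ℕ k
    V-y≤ = ℕₚ.≤-pred (ℕₚ.<-≤-trans (x∈p⇒∣p-x∣<∣p∣ y∈) V≤)
    fit : ∀ i → (m₁ i ⊓ 2 ^ℕ k) +ℕ (m₂ i ⊓ 2 ^ℕ k) ≤ℕ m i ⊓ 2 ^ℕ (suc k)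
    fit i = ℕₚ.⊓-glb
      (ℕₚ.≤-trans (ℕₚ.+-mono-≤ (ℕₚ.m⊓n≤m (m₁ i) _) (ℕₚ.m⊓n≤m (m₂ i) _)) (r i))
      (ℕₚ.≤-trans (ℕₚ.+-mono-≤ (ℕₚ.m⊓n≤n (m₁ i) _) (ℕₚ.m⊓n≤n (m₂ i) _))
                  (ℕₚ.≤-reflexive (cong (2 ^ℕ k +ℕ_) (sym (ℕₚ.+-identityʳ (2 ^ℕ k))))))

  -- A loop-free tree has at most 2 ^ l leaves, so larger multiplicities carry no information.
  bound : ℕ
  bound = 2 ^ℕ l

  truncate : Cost → Cost
  truncate m i = m i ⊓ bound

  covers-truncate : ∀ {y m} → Covers y m → Covers y (truncate m)
  covers-truncate c = loopFree⇒covers l (ℕₚ.≤-reflexive (∣⊤∣≡n l)) (covers⇒loopFree c)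

  -- Replacing m by m′ in any context keeps what is covered. Double negation makes this decidable.
  infix 4 _≼_
  record _≼_ (m m′ : Cost) : Set where
    constructor mk≼
    field covers : ∀ y z → Covers y (m ⊕ z) → ¬ ¬ Covers y (m′ ⊕ z)
  open _≼_ public

  ≼-dec : ∀ m m′ → Dec (m ≼ m′)
  ≼-dec m m′ with dec¬ (∃ λ y → ∃ λ z → Covers y (m ⊕ z) × ¬ Covers y (m′ ⊕ z))
  ... | yes n = yes (mk≼ λ y z c n′ → n (y , z , c , n′))
  ... | no ¬n = no λ p → ¬n λ (y , z , c , n′) → covers p y z c n′

  ≼-stable : ∀ {m m′} → ¬ ¬ m ≼ m′ → m ≼ m′
  ≼-stable ¬¬p = mk≼ λ y z c n → ¬¬p λ p → covers p y z c n

  ≤̇⇒≼ : ∀ {m m′} → m ≤̇ m′ → m ≼ m′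
  ≤̇⇒≼ p = mk≼ λ y z c n → n (covers-mono (λ i → ℕₚ.+-monoˡ-≤ (z i) (p i)) c)

  ≗⇒≼ : ∀ {m m′} → (∀ i → m i ≡ m′ i) → m ≼ m′
  ≗⇒≼ p = ≤̇⇒≼ λ i → ℕₚ.≤-reflexive (p i)

  ≼-refl : ∀ {m} → m ≼ m
  ≼-refl = ≤̇⇒≼ λ _ → ℕₚ.≤-refl

  ≼-trans : ∀ {m m′ m″} → m ≼ m′ → m′ ≼ m″ → m ≼ m″
  ≼-trans p q = mk≼ λ y z c n → covers p y z c λ c′ → covers q y z c′ n

  𝟘≼ : ∀ {m} → 𝟘 ≼ m
  𝟘≼ = ≤̇⇒≼ λ _ → z≤n

  ≼⊕ˡ : ∀ {m m′} → m ≼ m ⊕ m′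
  ≼⊕ˡ {m} {m′} = ≤̇⇒≼ λ i → ℕₚ.m≤m+n (m i) (m′ i)

  ≼⊕ʳ : ∀ {m m′} → m′ ≼ m ⊕ m′
  ≼⊕ʳ {m} {m′} = ≤̇⇒≼ λ i → ℕₚ.m≤n+m (m′ i) (m i)

  ⊕-comm-≼ : ∀ m m′ → m ⊕ m′ ≼ m′ ⊕ m
  ⊕-comm-≼ m m′ = ≗⇒≼ λ i → ℕₚ.+-comm (m i) (m′ i)

  ⊕-monoˡ : ∀ {m m′} w → m ≼ m′ → m ⊕ w ≼ m′ ⊕ w
  ⊕-monoˡ {m} {m′} w p = mk≼ λ y z c n → covers p y (w ⊕ z)
    (covers-mono (λ i → ℕₚ.≤-reflexive (ℕₚ.+-assoc (m i) (w i) (z i))) c)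
    λ c′ → n (covers-mono (λ i → ℕₚ.≤-reflexive (sym (ℕₚ.+-assoc (m′ i) (w i) (z i)))) c′)

  ⊕-mono : ∀ {m m′ w w′} → m ≼ m′ → w ≼ w′ → m ⊕ w ≼ m′ ⊕ w′
  ⊕-mono {m} {m′} {w} {w′} p q = ≼-trans (⊕-monoˡ w p)
    (≼-trans (⊕-comm-≼ m′ w) (≼-trans (⊕-monoˡ m′ q) (⊕-comm-≼ w′ m′)))

  covers⇒unit≼ : ∀ {y m} → Covers y m → unit y ≼ m
  covers⇒unit≼ c = mk≼ λ y z c′ n → n (covers-subst c c′ λ _ → ℕₚ.≤-refl)

  1≤unit : ∀ y → 1 ≤ℕ unit y y
  1≤unit y = ℕₚ.≤-reflexive (sym (𝟙-true (y ≟ y) refl))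

  unit-≼-+ : ∀ {y y₁ y₂} → val y ≤ val y₁ + val y₂ → unit y ≼ unit y₁ ⊕ unit y₂
  unit-≼-+ {y} {y₁} {y₂} p = covers⇒unit≼ (node {m₁ = unit y₁} {m₂ = unit y₂} p (leaf y₁ ≤-refl (1≤unit y₁)) (leaf y₂ ≤-refl (1≤unit y₂)) λ _ → ℕₚ.≤-refl)

  unit-≼-0 : ∀ {y} → val y ≤ 0ℝ → unit y ≼ 𝟘
  unit-≼-0 p = covers⇒unit≼ (free p)

  unit-≼-mono : ∀ {y y′} → val y ≤ val y′ → unit y ≼ unit y′
  unit-≼-mono {y} {y′} p = covers⇒unit≼ (leaf y′ p (1≤unit y′))

  unit-≼-sound : ∀ {y m} → unit y ≼ m → val y ≤ total m
  unit-≼-sound {y} {m} p = ≤-stable λ n → covers p y 𝟘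
    (leaf y ≤-refl (ℕₚ.≤-trans (1≤unit y) (ℕₚ.m≤m+n _ 0)))
    λ c → n (≤-trans (covers-sound c) (≤-reflexive (trans (total-+ m 𝟘) (trans (cong (total m +_) total-zero) (+-identityʳ _)))))

  -- Finitely many codes for costs, and their ranks

  abstract
    Code : ℕ
    Code = suc bound ^ℕ l

    decode : Fin Code → Cost
    decode q i = toℕ (finToFun {suc bound} {l} q i)

    encode : Cost → Fin Code
    encode m = funToFin λ i → fromℕ< {m i ⊓ bound} (s≤s (ℕₚ.m⊓n≤n (m i) bound))

    decode-encode : ∀ m i → decode (encode m) i ≡ truncate m i
    decode-encode m i = trans (cong toℕ (Finₚ.finToFun-funToFin (λ i → fromℕ< {m i ⊓ bound} (s≤s (ℕₚ.m⊓n≤n (m i) bound))) i)) (Finₚ.toℕ-fromℕ< _)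

    decode-encode-≼ : ∀ m → decode (encode m) ≼ m
    decode-encode-≼ m = ≤̇⇒≼ λ i → ℕₚ.≤-trans (ℕₚ.≤-reflexive (decode-encode m i)) (ℕₚ.m⊓n≤m (m i) bound)

    -- By `covers-truncate` the whole budget `m ⊕ z` may be truncated; truncating `m` alone leaves
    -- at least as much.
    ≼-decode-encode : ∀ m → m ≼ decode (encode m)
    ≼-decode-encode m = mk≼ λ y z c n → n (covers-mono
      (λ i → ℕₚ.≤-trans (lem (m i) (z i)) (ℕₚ.≤-reflexive (cong (_+ℕ z i) (sym (decode-encode m i))))) (covers-truncate c))
      where
      lem : ∀ a b → (a +ℕ b) ⊓ bound ≤ℕ (a ⊓ bound) +ℕ b
      lem a b with ℕₚ.≤-total a bound
      ... | inj₁ p rewrite ℕₚ.m≤n⇒m⊓n≡m p = ℕₚ.m⊓n≤m (a +ℕ b) bound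
      ... | inj₂ p rewrite ℕₚ.m≥n⇒m⊓n≡n p = ℕₚ.≤-trans (ℕₚ.m⊓n≤n (a +ℕ b) bound) (ℕₚ.m≤m+n bound b)

  -- Ranks make the preorder `≼` linear: comparable codes have equal rank only if they are
  -- equivalent (`rank-reflect`).
  rank : Fin Code → ℕ
  rank q = count λ q′ → ≼-dec (decode q′) (decode q)

  rank-mono : ∀ q q′ → decode q ≼ decode q′ → rank q ≤ℕ rank q′
  rank-mono q q′ p = count-mono (λ r → ≼-dec (decode r) (decode q)) (λ r → ≼-dec (decode r) (decode q′)) λ r s → ≼-trans s p

  rank-reflect : ∀ q q′ → decode q ≼ decode q′ → rank q ≡ rank q′ → decode q′ ≼ decode q
  rank-reflect q q′ p e = ≼-stable λ n → ℕₚ.<-irrefl e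
    (count-mono-< (λ r → ≼-dec (decode r) (decode q)) (λ r → ≼-dec (decode r) (decode q′)) (λ r s → ≼-trans s p) q′ ≼-refl n)

  rank≤ : ∀ q → rank q ≤ℕ Code
  rank≤ q = count-≤N λ q′ → ≼-dec (decode q′) (decode q)

-- Finite subsets, their codes and images

private variable
  n : ℕ

comprehension : {P : Fin n → Set} → Decidable₁ P → Subset n
comprehension P? = Vec.tabulate λ x → ⌊ P? x ⌋

∈-comprehension⁺ : {P : Fin n → Set} (P? : Decidable₁ P) → ∀ {x} → P x → x ∈ comprehension P?
∈-comprehension⁺ P? {x} p = Vecₚ.lookup⇒[]= x _ (trans (Vecₚ.lookup∘tabulate _ x) (lem (P? x)))
  where
  lem : (d : Dec _) → ⌊ d ⌋ ≡ true
  lem (yes _) = refl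
  lem (no ¬p) = ⊥-elim (¬p p)

∈-comprehension⁻ : {P : Fin n → Set} (P? : Decidable₁ P) → ∀ {x} → x ∈ comprehension P? → P x
∈-comprehension⁻ P? {x} p with P? x | trans (sym (Vecₚ.lookup∘tabulate (λ y → ⌊ P? y ⌋) x)) (Vecₚ.[]=⇒lookup p)
... | yes q | _ = q

AtMostOne : Subset n → Set
AtMostOne X = ∀ {x y} → x ∈ X → y ∈ X → x ≡ y

∣X∣≤1⇒atMostOne : (X : Subset n) → ∣ X ∣ ≤ℕ 1 → AtMostOne X
∣X∣≤1⇒atMostOne X X≤1 {x} {y} x∈ y∈ with y ≟ x
... | yes e = sym e
... | no y≢x = ⊥-elim (ℕₚ.<-irrefl refl (ℕₚ.<-≤-trans
      (ℕₚ.≤-<-trans (subst (_≤ℕ ∣ X - x ∣) (∣⁅x⁆∣≡1 y)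
        (p⊆q⇒∣p∣≤∣q∣ λ p → subst (_∈ X - x) (sym (x∈⁅y⁆⇒x≡y y p)) (x∈p∧x≢y⇒x∈p-y y∈ y≢x)))
      (x∈p⇒∣p-x∣<∣p∣ x∈)) X≤1))

atMostOne⇒∣X∣≤1 : (X : Subset n) → AtMostOne X → ∣ X ∣ ≤ℕ 1
atMostOne⇒∣X∣≤1 {n} X h with nonempty? X
... | yes (x , x∈) = ℕₚ.≤-trans (p⊆q⇒∣p∣≤∣q∣ λ {y} y∈ → subst (_∈ ⁅ x ⁆) (h x∈ y∈) (x∈⁅x⁆ x)) (ℕₚ.≤-reflexive (∣⁅x⁆∣≡1 x))
... | no empty = ℕₚ.≤-trans (ℕₚ.≤-reflexive (trans (cong ∣_∣ (Empty-unique empty)) (∣⊥∣≡0 n))) z≤n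

∪-⊆ : {X Y Z : Subset n} → X ⊆ Z → Y ⊆ Z → X ∪ Y ⊆ Z
∪-⊆ {X = X} {Y} f g p = [ f , g ]′ (x∈p∪q⁻ X Y p)

∪-mono : {X X′ Y Y′ : Subset n} → X ⊆ X′ → Y ⊆ Y′ → X ∪ Y ⊆ X′ ∪ Y′
∪-mono {X′ = X′} {Y′ = Y′} f g = ∪-⊆ (⊆-trans f (p⊆p∪q Y′)) (⊆-trans g (q⊆p∪q X′ Y′))

⁅⁆-⊆ : ∀ {x} {X : Subset n} → x ∈ X → ⁅ x ⁆ ⊆ X
⁅⁆-⊆ {x = x} {X} x∈ p = subst (_∈ X) (sym (x∈⁅y⁆⇒x≡y x p)) x∈

∈-∪ˡ : ∀ {x} (X Y : Subset n) → x ∈ X → x ∈ X ∪ Y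
∈-∪ˡ X Y = p⊆p∪q Y

∈-∪ʳ : ∀ {x} (X Y : Subset n) → x ∈ Y → x ∈ X ∪ Y
∈-∪ʳ X Y = q⊆p∪q X Y

-- Subsets of Fin k, coded by Fin (2 ^ k)
_∋ᶜ_ : ∀ {k} → Fin (2 ^ℕ k) → Fin k → Set
_∋ᶜ_ {k} s i = finToFun {2} {k} s i ≡ suc zero

_∋ᶜ?_ : ∀ {k} (s : Fin (2 ^ℕ k)) i → Dec (s ∋ᶜ i)
_∋ᶜ?_ {k} s i = finToFun {2} {k} s i ≟ suc zero

bit : {P : Set} → Dec P → Fin 2
bit (yes _) = suc zero
bit (no _)  = zero

setCode : ∀ {k} {P : Fin k → Set} → Decidable₁ P → Fin (2 ^ℕ k)
setCode P? = funToFin λ i → bit (P? i)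

setCode⁺ : ∀ {k} {P : Fin k → Set} (P? : Decidable₁ P) i → P i → setCode P? ∋ᶜ i
setCode⁺ P? i p = trans (Finₚ.finToFun-funToFin (λ j → bit (P? j)) i) (lem (P? i))
  where
  lem : (d : Dec _) → bit d ≡ suc zero
  lem (yes _) = refl
  lem (no ¬p) = ⊥-elim (¬p p)

setCode⁻ : ∀ {k} {P : Fin k → Set} (P? : Decidable₁ P) i → setCode P? ∋ᶜ i → P i
setCode⁻ P? i e with P? i | trans (sym (Finₚ.finToFun-funToFin (λ j → bit (P? j)) i)) e
... | yes p | _ = p

funToFin-cong : ∀ {m k} {f g : Fin m → Fin k} → (∀ i → f i ≡ g i) → funToFin f ≡ funToFin g
funToFin-cong {zero}  h = refl
funToFin-cong {suc m} h = cong₂ combine (h zero) (funToFin-cong (h ∘ suc))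

finToFun-injective : ∀ {m k} (a b : Fin (k ^ℕ m)) → (∀ i → finToFun {k} {m} a i ≡ finToFun {k} {m} b i) → a ≡ b
finToFun-injective {m} {k} a b h =
  trans (sym (Finₚ.funToFin-finToFin {m} {k} a)) (trans (funToFin-cong h) (Finₚ.funToFin-finToFin {m} {k} b))

setCode-ext : ∀ {k} (s s′ : Fin (2 ^ℕ k)) → (∀ i → s ∋ᶜ i → s′ ∋ᶜ i) → (∀ i → s′ ∋ᶜ i → s ∋ᶜ i) → s ≡ s′
setCode-ext {k} s s′ f g = finToFun-injective {k} {2} s s′ λ i → lem (finToFun {2} {k} s i) (finToFun {2} {k} s′ i) (f i) (g i)
  where
  lem : (a b : Fin 2) → (a ≡ suc zero → b ≡ suc zero) → (b ≡ suc zero → a ≡ suc zero) → a ≡ b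
  lem zero       zero       f g = refl
  lem zero       (suc zero) f g = g refl
  lem (suc zero) zero       f g = sym (f refl)
  lem (suc zero) (suc zero) f g = refl

module _ (R : RealField) {n m : ℕ} (f : Fin n → Fin m) where

  private
    image? : ∀ X y → Dec (∃ λ x → x ∈ X × f x ≡ y)
    image? X y = Finₚ.any? λ x → (x ∈? X) ×-dec (f x ≟ y)

  ∈-image⁺ : ∀ {X x} → x ∈ X → f x ∈ image R f X
  ∈-image⁺ {X} {x} p = ∈-comprehension⁺ (image? X) (x , p , refl)

  ∈-image⁻ : ∀ {X y} → y ∈ image R f X → ∃ λ x → x ∈ X × f x ≡ y
  ∈-image⁻ {X} = ∈-comprehension⁻ (image? X)

  ∣image∣≤1 : ∀ {X} → ∣ X ∣ ≤ℕ 1 → ∣ image R f X ∣ ≤ℕ 1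
  ∣image∣≤1 {X} X≤1 = atMostOne⇒∣X∣≤1 _ λ y∈ z∈ → lem (∈-image⁻ y∈) (∈-image⁻ z∈)
    where
    lem : ∀ {y z} → (∃ λ x → x ∈ X × f x ≡ y) → (∃ λ x → x ∈ X × f x ≡ z) → y ≡ z
    lem (x , x∈ , refl) (x′ , x′∈ , refl) = cong f (∣X∣≤1⇒atMostOne X X≤1 x∈ x′∈)

  ∣image∣≤1⁻ : (∀ {x y} → f x ≡ f y → x ≡ y) → ∀ {X} → ∣ image R f X ∣ ≤ℕ 1 → ∣ X ∣ ≤ℕ 1
  ∣image∣≤1⁻ inj {X} h = atMostOne⇒∣X∣≤1 X λ x∈ y∈ → inj (∣X∣≤1⇒atMostOne _ h (∈-image⁺ x∈) (∈-image⁺ y∈))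

-- Monotonicity of a diversity and costs of its subsets

module Extension (R : RealField) {n : ℕ} (A : Diversity R n) where
  open RealLemmas R
  open Diversity A

  -- The triangle inequality through `⁅ x ⁆` with empty third set; its last term is the distance of
  -- a singleton, hence zero.
  d-mono-insert : ∀ X x → d X ≤ d (X ∪ ⁅ x ⁆)
  d-mono-insert X x = subst (d X ≤_) (trans (cong (d (X ∪ ⁅ x ⁆) +_)
      (proj₂ (zero-iff (⁅ x ⁆ ∪ ⊥)) (ℕₚ.≤-reflexive (trans (cong ∣_∣ (∪-identityʳ ⁅ x ⁆)) (∣⁅x⁆∣≡1 x))))) (+-identityʳ _))
    (≤-trans (≤-reflexive (cong d (sym (∪-identityʳ X)))) (triangle X ⁅ x ⁆ ⊥ (x , x∈⁅x⁆ x)))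

  d-mono : ∀ {X Y} → X ⊆ Y → d X ≤ d Y
  d-mono {X} {Y} X⊆Y = go (∣ Y ∣) X X⊆Y (ℕₚ.m≤n+m _ _)
    where
    go : ∀ k X → X ⊆ Y → ∣ Y ∣ ≤ℕ ∣ X ∣ +ℕ k → d X ≤ d Y
    go k X X⊆Y le with Finₚ.any? (λ x → (x ∈? Y) ×-dec ¬? (x ∈? X))
    ... | no none = ≤-reflexive (cong d (⊆-antisym X⊆Y λ {x} x∈Y → decidable-stable (x ∈? X) λ x∉X → none (x , x∈Y , x∉X)))
    ... | yes (x , x∈Y , x∉X) with ℕₚ.<-≤-trans (p⊂q⇒∣p∣<∣q∣ (X⊆Y , x , x∈Y , x∉X)) le
    go zero X X⊆Y le | yes (x , x∈Y , x∉X) | lt = ⊥-elim (ℕₚ.<-irrefl (sym (ℕₚ.+-identityʳ _)) lt)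
    go (suc k) X X⊆Y le | yes (x , x∈Y , x∉X) | lt = ≤-trans (d-mono-insert X x)
      (go k (X ∪ ⁅ x ⁆) (∪-⊆ X⊆Y (⁅⁆-⊆ x∈Y)) (ℕₚ.≤-trans le (ℕₚ.≤-trans (ℕₚ.≤-reflexive (ℕₚ.+-suc _ k))
        (ℕₚ.+-monoˡ-≤ k (p⊂q⇒∣p∣<∣q∣ (p⊆p∪q ⁅ x ⁆ , x , ∈-∪ʳ X ⁅ x ⁆ (x∈⁅x⁆ x) , x∉X))))))

  -- The triangle inequality through the common point `x`, which both sets absorb.
  d-join : ∀ {W X Y x} → x ∈ X → x ∈ Y → W ⊆ X ∪ Y → d W ≤ d X + d Y
  d-join {W} {X} {Y} {x} x∈X x∈Y W⊆ = ≤-trans (d-mono W⊆) (≤-trans (triangle X ⁅ x ⁆ Y (x , x∈⁅x⁆ x))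
    (+-mono-≤ (d-mono (∪-⊆ ⊆-refl (⁅⁆-⊆ x∈X))) (d-mono (∪-⊆ (⁅⁆-⊆ x∈Y) ⊆-refl))))

  l : ℕ
  l = 2 ^ℕ n

  subsetOf : Fin l → Subset n
  subsetOf s = comprehension (s ∋ᶜ?_)

  label : Subset n → Fin l
  label X = setCode (_∈? X)

  subsetOf-label : ∀ X → subsetOf (label X) ≡ X
  subsetOf-label X = ⊆-antisym
    (λ {x} p → setCode⁻ (_∈? X) x (∈-comprehension⁻ (label X ∋ᶜ?_) p))
    (λ {x} p → ∈-comprehension⁺ (label X ∋ᶜ?_) (setCode⁺ (_∈? X) x p))

  val : Fin l → ℝ
  val i = d (subsetOf i)

  val-label : ∀ X → val (label X) ≡ d X
  val-label X = cong d (subsetOf-label X)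

  open Total val (λ i → nonneg (subsetOf i))
  open Costs R val (λ i → nonneg (subsetOf i))

  γ : Subset n → Cost
  γ X = unit (label X)

  γ-mono-≤ : ∀ {X Y} → d X ≤ d Y → γ X ≼ γ Y
  γ-mono-≤ {X} {Y} p = unit-≼-mono (subst (λ v → v ≤ val (label Y)) (sym (val-label X)) (subst (d X ≤_) (sym (val-label Y)) p))

  γ-mono : ∀ {X Y} → X ⊆ Y → γ X ≼ γ Y
  γ-mono p = γ-mono-≤ (d-mono p)

  γ-join : ∀ {W X Y x} → x ∈ X → x ∈ Y → W ⊆ X ∪ Y → γ W ≼ γ X ⊕ γ Y
  γ-join {W} {X} {Y} p q r = unit-≼-+ (subst (_≤ val (label X) + val (label Y)) (sym (val-label W))
    (subst (d W ≤_) (sym (cong₂ _+_ (val-label X) (val-label Y))) (d-join p q r)))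

  γ-point : ∀ {X} x → X ⊆ ⁅ x ⁆ → γ X ≼ 𝟘
  γ-point {X} x p = unit-≼-0 (≤-reflexive (trans (val-label X) (proj₂ (zero-iff X)
    (ℕₚ.≤-trans (p⊆q⇒∣p∣≤∣q∣ p) (ℕₚ.≤-reflexive (∣⁅x⁆∣≡1 x))))))

  γ-sound : ∀ {X m} → γ X ≼ m → d X ≤ total m
  γ-sound {X} {m} p = subst (_≤ total m) (val-label X) (unit-≼-sound p)

  total-γ : ∀ X → total (γ X) ≡ d X
  total-γ X = trans (total-unit (label X)) (val-label X)

  -- Facts and derivations

  -- A fact at a point x, a pair of a set W and a cost, says that x is connected to W at that cost.
  abstract
    Φ : ℕ
    Φ = l *ℕ Code

    lbl : Fin Φ → Subset n
    lbl φ = subsetOf (proj₁ (remQuot {l} Code φ))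

    cod : Fin Φ → Fin Code
    cod φ = proj₂ (remQuot {l} Code φ)

    fact : Subset n → Cost → Fin Φ
    fact X m = combine (label X) (encode m)

    lbl-fact : ∀ X m → lbl (fact X m) ≡ X
    lbl-fact X m = trans (cong (subsetOf ∘ proj₁) (Finₚ.remQuot-combine {l} {Code} (label X) (encode m))) (subsetOf-label X)

    cod-fact : ∀ X m → cod (fact X m) ≡ encode m
    cod-fact X m = cong proj₂ (Finₚ.remQuot-combine {l} {Code} (label X) (encode m))

  cost : Fin Φ → Cost
  cost φ = decode (cod φ)

  cost-fact-≼ : ∀ X m → cost (fact X m) ≼ m
  cost-fact-≼ X m = subst (_≼ m) (cong decode (sym (cod-fact X m))) (decode-encode-≼ m)

  ≼-cost-fact : ∀ X m → m ≼ cost (fact X m)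
  ≼-cost-fact X m = subst (m ≼_) (cong decode (sym (cod-fact X m))) (≼-decode-encode m)

  FactSet : Set₁
  FactSet = Fin n → Fin Φ → Set

  -- A list of facts at points of `Z` whose labels together contain the set and whose costs fit into
  -- the given cost. The slack at every step makes weakening immediate.
  data Premises (F : FactSet) (Z : Subset n) : Subset n → Cost → Set where
    nil : ∀ {W m} → W ⊆ ⊥ → Premises F Z W m
    add : ∀ {W W′ m m′} z φ → F z φ → z ∈ Z → Premises F Z W m →
          W′ ⊆ lbl φ ∪ W → cost φ ⊕ m ≼ m′ → Premises F Z W′ m′

  record Derives (F : FactSet) (x : Fin n) (X : Subset n) (c : Cost) : Set where
    constructor derives
    field
      {Z}      : Subset n
      {m}      : Cost
      x∈Z      : x ∈ Z
      premises : Premises F Z X m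
      cheap    : γ Z ⊕ m ≼ c

  _⊢_∶_ : FactSet → Fin n → Fin Φ → Set
  F ⊢ x ∶ φ = Derives F x (lbl φ) (cost φ)

  premises-shrink : ∀ {F Z W W′ m} → W′ ⊆ W → Premises F Z W m → Premises F Z W′ m
  premises-shrink s (nil q) = nil (⊆-trans s q)
  premises-shrink s (add z φ f z∈ ps q r) = add z φ f z∈ ps (⊆-trans s q) r

  premises-weaken : ∀ {F Z Z′ W m m′} → Z ⊆ Z′ → m ≼ m′ → Premises F Z W m → Premises F Z′ W m′
  premises-weaken Z⊆ p (nil q) = nil q
  premises-weaken Z⊆ p (add z φ f z∈ ps q r) = add z φ f (Z⊆ z∈) (premises-weaken Z⊆ ≼-refl ps) q (≼-trans r p)

  -- The hypothesis is granted a cost bound because no premise costs more than all of them together;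
  -- arguments by rank rely on it.
  premises-map : ∀ {F G Z W m} → (∀ z φ → cost φ ≼ m → F z φ → G z φ) → Premises F Z W m → Premises G Z W m
  premises-map h (nil q) = nil q
  premises-map h (add z φ f z∈ ps q r) = add z φ (h z φ (≼-trans ≼⊕ˡ r) f) z∈
    (premises-map (λ z′ φ′ p → h z′ φ′ (≼-trans p (≼-trans ≼⊕ʳ r))) ps) q r

  premises-map-¬¬ : ∀ {F G Z W m} → (∀ z φ → cost φ ≼ m → F z φ → ¬ ¬ G z φ) → Premises F Z W m → ¬ ¬ Premises G Z W m
  premises-map-¬¬ h (nil q) k = k (nil q)
  premises-map-¬¬ h (add z φ f z∈ ps q r) k = h z φ (≼-trans ≼⊕ˡ r) f λ g →
    premises-map-¬¬ (λ z′ φ′ p → h z′ φ′ (≼-trans p (≼-trans ≼⊕ʳ r))) ps λ ps′ → k (add z φ g z∈ ps′ q r)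

  ⊕-assoc-≼ : ∀ a b c → a ⊕ (b ⊕ c) ≼ (a ⊕ b) ⊕ c
  ⊕-assoc-≼ a b c = ≗⇒≼ λ i → sym (ℕₚ.+-assoc (a i) (b i) (c i))

  ⊕-assoc-≽ : ∀ a b c → (a ⊕ b) ⊕ c ≼ a ⊕ (b ⊕ c)
  ⊕-assoc-≽ a b c = ≗⇒≼ λ i → ℕₚ.+-assoc (a i) (b i) (c i)

  ⊕-swap-≼ : ∀ a b c → a ⊕ (b ⊕ c) ≼ b ⊕ (a ⊕ c)
  ⊕-swap-≼ a b c = ≗⇒≼ λ i → lem (a i) (b i) (c i)
    where
    lem : ∀ a b c → a +ℕ (b +ℕ c) ≡ b +ℕ (a +ℕ c)
    lem = solve-∀

  ⊕-interchange-≼ : ∀ a b c e → (a ⊕ b) ⊕ (c ⊕ e) ≼ (a ⊕ c) ⊕ (b ⊕ e)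
  ⊕-interchange-≼ a b c e = ≗⇒≼ λ i → lem (a i) (b i) (c i) (e i)
    where
    lem : ∀ a b c e → (a +ℕ b) +ℕ (c +ℕ e) ≡ (a +ℕ c) +ℕ (b +ℕ e)
    lem = solve-∀

  premises-++ : ∀ {F Z W W′ m m′} → Premises F Z W m → Premises F Z W′ m′ → Premises F Z (W ∪ W′) (m ⊕ m′)
  premises-++ {W = W} {W′} (nil q) ps = premises-shrink (∪-⊆ (λ p → ⊥-elim (∉⊥ (q p))) ⊆-refl) (premises-weaken ⊆-refl ≼⊕ʳ ps)
  premises-++ {W′ = W′} {m′ = m′} (add {W = W₁} {m = m₁} z φ f z∈ ps q r) ps′ =
    add z φ f z∈ (premises-++ ps ps′)
      (∪-⊆ (⊆-trans q (∪-mono ⊆-refl (p⊆p∪q W′))) (⊆-trans (q⊆p∪q W₁ W′) (q⊆p∪q (lbl φ) (W₁ ∪ W′))))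
      (≼-trans (⊕-assoc-≼ (cost φ) m₁ m′) (⊕-monoˡ m′ r))

  ⊢-map : ∀ {F G x X c} → (∀ z φ → cost φ ≼ c → F z φ → G z φ) → Derives F x X c → Derives G x X c
  ⊢-map h (derives x∈ ps p) = derives x∈ (premises-map (λ z φ q → h z φ (≼-trans q (≼-trans ≼⊕ʳ p))) ps) p

  ⊢-map-¬¬ : ∀ {F G x X c} → (∀ z φ → cost φ ≼ c → F z φ → ¬ ¬ G z φ) → Derives F x X c → ¬ ¬ Derives G x X c
  ⊢-map-¬¬ h (derives x∈ ps p) k = premises-map-¬¬ (λ z φ q → h z φ (≼-trans q (≼-trans ≼⊕ʳ p))) ps
    λ ps′ → k (derives x∈ ps′ p)

  ⊢-near : ∀ {F x y φ X c} → F x φ → X ⊆ lbl φ → γ (⁅ x ⁆ ∪ ⁅ y ⁆) ⊕ cost φ ≼ c → Derives F y X c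
  ⊢-near {x = x} {y} {φ} f X⊆ p = derives (∈-∪ʳ ⁅ x ⁆ ⁅ y ⁆ (x∈⁅x⁆ y))
    (add {m = 𝟘} x φ f (∈-∪ˡ ⁅ x ⁆ ⁅ y ⁆ (x∈⁅x⁆ x)) (nil ⊆-refl) (⊆-trans X⊆ (p⊆p∪q ⊥))
      (≗⇒≼ λ i → ℕₚ.+-identityʳ (cost φ i))) p

  γ-pair-self : ∀ x → γ (⁅ x ⁆ ∪ ⁅ x ⁆) ≼ 𝟘
  γ-pair-self x = γ-point x (∪-⊆ ⊆-refl ⊆-refl)

  ⊢-axiom : ∀ {F x φ} → F x φ → F ⊢ x ∶ φ
  ⊢-axiom {x = x} {φ} f = ⊢-near f ⊆-refl (⊕-monoˡ (cost φ) (γ-pair-self x))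

  -- Cut elimination for derivations: the premise at `z` is derived over a set `Z″` containing `z`,
  -- so `Z″` and the set built so far meet in `z`, and `γ-join` bounds the cost of their union.
  premises-trans : ∀ {F G Z W m} → (∀ x φ → F x φ → G ⊢ x ∶ φ) → Premises F Z W m →
                   ∃ λ Z′ → Z ⊆ Z′ × ∃ λ m′ → Premises G Z′ W m′ × γ Z′ ⊕ m′ ≼ γ Z ⊕ m
  premises-trans {Z = Z} {m = m} h (nil q) = Z , ⊆-refl , m , nil q , ≼-refl
  premises-trans {Z = Z} {m = m} h (add {m = m₁} z φ f z∈ ps q r) with premises-trans h ps | h z φ f
  ... | Z′ , Z⊆Z′ , m′ , ps′ , le | derives {Z″} {m″} z∈Z″ ps″ le″ =
    Z″ ∪ Z′ , ⊆-trans Z⊆Z′ (q⊆p∪q Z″ Z′) , m″ ⊕ m′ ,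
    premises-shrink q (premises-++ (premises-weaken (p⊆p∪q Z′) ≼-refl ps″) (premises-weaken (q⊆p∪q Z″ Z′) ≼-refl ps′)) ,
    ≼-trans (⊕-monoˡ (m″ ⊕ m′) (γ-join z∈Z″ (Z⊆Z′ z∈) ⊆-refl))
      (≼-trans (⊕-interchange-≼ (γ Z″) (γ Z′) m″ m′)
      (≼-trans (⊕-mono le″ le)
      (≼-trans (⊕-swap-≼ (cost φ) (γ Z) m₁) (⊕-mono ≼-refl r))))

  ⊢-trans : ∀ {F G x X c} → (∀ x φ → F x φ → G ⊢ x ∶ φ) → Derives F x X c → Derives G x X c
  ⊢-trans h (derives x∈ ps p) with premises-trans h ps
  ... | Z′ , Z⊆Z′ , m′ , ps′ , le = derives (Z⊆Z′ x∈) ps′ (≼-trans le p)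

  -- Ranks of facts and facts that derive each other

  rk : Fin Φ → ℕ
  rk φ = rank (cod φ)

  Below : ℕ → FactSet → FactSet
  Below j F x φ = F x φ × rk φ <ℕ j

  -- Each premise costs at most `decode q`; if its rank is not below that of `q`, the two costs are
  -- equivalent by `rank-reflect`.
  premises-split : ∀ {F Z W m} q → Premises F Z W m → m ≼ decode q →
    Premises (Below (rank q) F) Z W m ⊎
    (∃ λ z → ∃ λ φ → F z φ × z ∈ Z × cost φ ≼ m × decode q ≼ cost φ)
  premises-split q (nil p) le = inj₁ (nil p)
  premises-split q (add {m = m₁} z φ f z∈ ps p r) le with premises-split q ps (≼-trans ≼⊕ʳ (≼-trans r le))
  ... | inj₂ (z′ , φ′ , f′ , z′∈ , s , t) = inj₂ (z′ , φ′ , f′ , z′∈ , ≼-trans s (≼-trans ≼⊕ʳ r) , t)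
  ... | inj₁ ps′ with rank (cod φ) ℕₚ.<? rank q
  ...   | yes lt = inj₁ (add z φ (f , lt) z∈ ps′ p r)
  ...   | no ≮ = inj₂ (z , φ , f , z∈ , ≼-trans ≼⊕ˡ r ,
            rank-reflect (cod φ) q φ≼ (ℕₚ.≤-antisym (rank-mono (cod φ) q φ≼) (ℕₚ.≮⇒≥ ≮)))
    where
    φ≼ : cost φ ≼ decode q
    φ≼ = ≼-trans ≼⊕ˡ (≼-trans r le)

  -- The field `near` says that the cost absorbs the distance from `x` to `y`; hence either fact
  -- derives the other, by `same-⊢`.
  record Same (x : Fin n) (φ : Fin Φ) (y : Fin n) (ψ : Fin Φ) : Set where
    constructor same
    field
      lbl≡  : lbl φ ≡ lbl ψ
      cost≼ : cost φ ≼ cost ψ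
      cost≽ : cost ψ ≼ cost φ
      near  : γ (⁅ x ⁆ ∪ ⁅ y ⁆) ⊕ cost φ ≼ cost φ

  same-refl : ∀ {x φ} → Same x φ x φ
  same-refl {x} {φ} = same refl ≼-refl ≼-refl (⊕-monoˡ (cost φ) (γ-pair-self x))

  same-sym : ∀ {x φ y ψ} → Same x φ y ψ → Same y ψ x φ
  same-sym {x} {φ} {y} {ψ} (same e p q r) = same (sym e) q p
    (≼-trans (⊕-mono (γ-mono (∪-⊆ (q⊆p∪q ⁅ x ⁆ ⁅ y ⁆) (p⊆p∪q ⁅ y ⁆))) q) (≼-trans r p))

  same-trans : ∀ {x φ y ψ z χ} → Same x φ y ψ → Same y ψ z χ → Same x φ z χ
  same-trans {x} {φ} {y} {ψ} {z} {χ} (same e p q r) (same e′ p′ q′ r′) =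
    same (trans e e′) (≼-trans p p′) (≼-trans q′ q)
      (≼-trans (⊕-monoˡ (cost φ) (γ-join (∈-∪ʳ ⁅ x ⁆ ⁅ y ⁆ (x∈⁅x⁆ y)) (∈-∪ˡ ⁅ y ⁆ ⁅ z ⁆ (x∈⁅x⁆ y))
        (∪-mono (p⊆p∪q ⁅ y ⁆) (q⊆p∪q ⁅ y ⁆ ⁅ z ⁆))))
      (≼-trans (⊕-assoc-≽ (γ (⁅ x ⁆ ∪ ⁅ y ⁆)) (γ (⁅ y ⁆ ∪ ⁅ z ⁆)) (cost φ))
      (≼-trans (⊕-mono ≼-refl (≼-trans (⊕-mono ≼-refl p) (≼-trans r′ q))) r)))

  same-rk : ∀ {x φ y ψ} → Same x φ y ψ → rk φ ≡ rk ψ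
  same-rk {φ = φ} {ψ = ψ} s = ℕₚ.≤-antisym (rank-mono (cod φ) (cod ψ) (Same.cost≼ s)) (rank-mono (cod ψ) (cod φ) (Same.cost≽ s))

  same-⊢ : ∀ {F : FactSet} {x φ y ψ} → Same x φ y ψ → F x φ → F ⊢ y ∶ ψ
  same-⊢ (same e p q r) f = ⊢-near f (⊆-reflexive (sym e)) (≼-trans r p)

  same-⊢′ : ∀ {F : FactSet} {x φ y ψ} → Same x φ y ψ → F ⊢ x ∶ φ → F ⊢ y ∶ ψ
  same-⊢′ {F} s t = ⊢-trans {F = λ z χ → F ⊢ z ∶ χ} (λ _ _ u → u) (same-⊢ s t)

  same? : ∀ x φ y ψ → Dec (Same x φ y ψ)
  same? x φ y ψ with Vecₚ.≡-dec Data.Bool._≟_ (lbl φ) (lbl ψ) | ≼-dec (cost φ) (cost ψ) | ≼-dec (cost ψ) (cost φ)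
                     | ≼-dec (γ (⁅ x ⁆ ∪ ⁅ y ⁆) ⊕ cost φ) (cost φ)
  ... | yes e | yes p | yes q | yes r = yes (same e p q r)
  ... | no ¬e | _ | _ | _ = no (¬e ∘ Same.lbl≡)
  ... | yes _ | no ¬p | _ | _ = no (¬p ∘ Same.cost≼)
  ... | yes _ | yes _ | no ¬q | _ = no (¬q ∘ Same.cost≽)
  ... | yes _ | yes _ | yes _ | no ¬r = no (¬r ∘ Same.near)

  abstract
    E : ℕ
    E = n *ℕ Φ

    pt : Fin E → Fin n
    pt e = proj₁ (remQuot {n} Φ e)

    ph : Fin E → Fin Φ
    ph e = proj₂ (remQuot {n} Φ e)

    at : Fin n → Fin Φ → Fin E
    at = combine

    pt-at : ∀ x φ → pt (at x φ) ≡ x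
    pt-at x φ = cong proj₁ (Finₚ.remQuot-combine {n} {Φ} x φ)

    ph-at : ∀ x φ → ph (at x φ) ≡ φ
    ph-at x φ = cong proj₂ (Finₚ.remQuot-combine {n} {Φ} x φ)

  at⁺ : ∀ (P : Fin n → Fin Φ → Set) {x φ} → P x φ → P (pt (at x φ)) (ph (at x φ))
  at⁺ P {x} {φ} p rewrite pt-at x φ | ph-at x φ = p

  at⁻ : ∀ (P : Fin n → Fin Φ → Set) {x φ} → P (pt (at x φ)) (ph (at x φ)) → P x φ
  at⁻ P {x} {φ} p rewrite pt-at x φ | ph-at x φ = p

  SameE : Fin E → Fin E → Set
  SameE e e′ = Same (pt e) (ph e) (pt e′) (ph e′)

  Leader : Fin E → Set
  Leader e = ¬ ∃ λ e′ → toℕ e′ <ℕ toℕ e × SameE e′ e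

  smaller? : ∀ e → Dec (∃ λ e′ → toℕ e′ <ℕ toℕ e × SameE e′ e)
  smaller? e = Finₚ.any? λ e′ → (toℕ e′ ℕₚ.<? toℕ e) ×-dec same? (pt e′) (ph e′) (pt e) (ph e)

  abstract
    leader : ∀ e → ∃ λ e′ → Leader e′ × SameE e′ e
    leader e = go _ e ℕₚ.≤-refl
      where
      go : ∀ k e → toℕ e <ℕ k → ∃ λ e′ → Leader e′ × SameE e′ e
      go (suc k) e lt with smaller? e
      ... | no l = e , l , same-refl
      ... | yes (e′ , lt′ , s) with go k e′ (ℕₚ.<-≤-trans lt′ (ℕₚ.≤-pred lt))
      ...   | e″ , l , s′ = e″ , l , same-trans s′ s

  leader-unique : ∀ {e e′} → Leader e → Leader e′ → SameE e e′ → e ≡ e′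
  leader-unique {e} {e′} l l′ s with ℕₚ.<-cmp (toℕ e) (toℕ e′)
  ... | Relation.Binary.tri< lt _ _ = ⊥-elim (l′ (e , lt , s))
  ... | Relation.Binary.tri≈ _ eq _ = Finₚ.toℕ-injective eq
  ... | Relation.Binary.tri> _ _ gt = ⊥-elim (l (e′ , gt , same-sym s))

  -- Decorations, their order and their closure

  abstract
    T : ℕ
    T = 2 ^ℕ Φ

    _∋_ : Fin T → Fin Φ → Set
    t ∋ φ = t ∋ᶜ φ

    _∋?_ : ∀ t φ → Dec (t ∋ φ)
    t ∋? φ = t ∋ᶜ? φ

    ∋-ext : ∀ {t t′} → (∀ φ → t ∋ φ → t′ ∋ φ) → (∀ φ → t′ ∋ φ → t ∋ φ) → t ≡ t′
    ∋-ext {t} {t′} = setCode-ext t t′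

    S : ℕ
    S = T ^ℕ n

    _⟨_⟩ : Fin S → Fin n → Fin T
    c ⟨ x ⟩ = finToFun {T} {n} c x

    ⟨⟩-ext : ∀ {c c′} → (∀ x → c ⟨ x ⟩ ≡ c′ ⟨ x ⟩) → c ≡ c′
    ⟨⟩-ext {c} {c′} = finToFun-injective {n} {T} c c′

    system : {F : FactSet} → (∀ x φ → Dec (F x φ)) → Fin S
    system F? = funToFin λ x → setCode (F? x)

    system⁺ : {F : FactSet} (F? : ∀ x φ → Dec (F x φ)) → ∀ {x φ} → F x φ → (system F? ⟨ x ⟩) ∋ φ
    system⁺ F? {x} {φ} f = subst (_∋ᶜ φ) (sym (Finₚ.finToFun-funToFin (λ y → setCode (F? y)) x)) (setCode⁺ (F? x) φ f)

    system⁻ : {F : FactSet} (F? : ∀ x φ → Dec (F x φ)) → ∀ {x φ} → (system F? ⟨ x ⟩) ∋ φ → F x φ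
    system⁻ F? {x} {φ} f = setCode⁻ (F? x) φ (subst (_∋ᶜ φ) (Finₚ.finToFun-funToFin (λ y → setCode (F? y)) x) f)

  ⟦_⟧ : Fin S → FactSet
  ⟦ c ⟧ x φ = (c ⟨ x ⟩) ∋ φ

  ⟦_⟧? : ∀ c x φ → Dec (⟦ c ⟧ x φ)
  ⟦ c ⟧? x φ = (c ⟨ x ⟩) ∋? φ

  infix 4 _⊑_
  _⊑_ : Fin S → Fin S → Set
  c ⊑ c′ = ∀ x φ → ⟦ c ⟧ x φ → ⟦ c′ ⟧ x φ

  _⊑?_ : ∀ c c′ → Dec (c ⊑ c′)
  c ⊑? c′ = Finₚ.all? λ x → Finₚ.all? λ φ → ⟦ c ⟧? x φ →-dec ⟦ c′ ⟧? x φ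

  ⊑-refl : ∀ c → c ⊑ c
  ⊑-refl c x φ f = f

  ⊑-antisym : ∀ {c c′} → c ⊑ c′ → c′ ⊑ c → c ≡ c′
  ⊑-antisym p q = ⟨⟩-ext λ x → ∋-ext (p x) (q x)

  difference : ∀ {c c′} → ¬ c′ ⊑ c → ∃ λ e → ⟦ c′ ⟧ (pt e) (ph e) × ¬ ⟦ c ⟧ (pt e) (ph e)
  difference {c} {c′} ¬p with Finₚ.any? (λ e → ⟦ c′ ⟧? (pt e) (ph e) ×-dec ¬? (⟦ c ⟧? (pt e) (ph e)))
  ... | yes q = q
  ... | no ¬q = ⊥-elim (¬p λ x φ f → decidable-stable (⟦ c ⟧? x φ) λ ¬f → ¬q (at x φ , at⁺ ⟦ c′ ⟧ f , λ g → ¬f (at⁻ ⟦ c ⟧ g)))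

  -- The height for Möbius inversion: it falls as the decoration grows.
  absent : Fin S → ℕ
  absent c = count λ e → ¬? (⟦ c ⟧? (pt e) (ph e))

  absent-< : ∀ c c′ → c ⊑ c′ → c ≢ c′ → absent c′ <ℕ absent c
  absent-< c c′ p c≢ with difference {c} {c′} (λ q → c≢ (⊑-antisym p q))
  ... | e , f , ¬f = count-mono-< (λ e → ¬? (⟦ c′ ⟧? (pt e) (ph e))) (λ e → ¬? (⟦ c ⟧? (pt e) (ph e)))
                       (λ e′ ¬g g → ¬g (p _ _ g)) e ¬f (λ ¬f′ → ¬f′ f)

  -- Stated negatively, so that `dec¬` decides it although derivability is not decided. By
  -- `closed-∈`, derivability under double negation gives membership.
  Closed : Fin S → Set
  Closed c = ∀ x φ → ¬ (⟦ c ⟧ ⊢ x ∶ φ × ¬ ⟦ c ⟧ x φ)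

  closed? : ∀ c → Dec (Closed c)
  closed? c = Finₚ.all? λ x → Finₚ.all? λ φ → dec¬ _

  closed-∈ : ∀ {c} → Closed c → ∀ {x φ} → ¬ ¬ (⟦ c ⟧ ⊢ x ∶ φ) → ⟦ c ⟧ x φ
  closed-∈ {c} cl {x} {φ} ¬¬t = decidable-stable (⟦ c ⟧? x φ) λ ¬f → ¬¬t λ t → cl x φ (t , ¬f)

  closed-same : ∀ {c x φ y ψ} → Closed c → Same x φ y ψ → ⟦ c ⟧ x φ → ⟦ c ⟧ y ψ
  closed-same cl s f = closed-∈ cl λ k → k (same-⊢ s f)

  closure? : ∀ F x φ → Dec (¬ ¬ (F ⊢ x ∶ φ))
  closure? F x φ = dec¬ _

  abstract
    closure : FactSet → Fin S
    closure F = system (closure? F)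

    closure⁺ : ∀ {F x φ} → ¬ ¬ (F ⊢ x ∶ φ) → ⟦ closure F ⟧ x φ
    closure⁺ {F} = system⁺ (closure? F)

    closure⁻ : ∀ {F x φ} → ⟦ closure F ⟧ x φ → ¬ ¬ (F ⊢ x ∶ φ)
    closure⁻ {F} = system⁻ (closure? F)

  closure-closed : ∀ F → Closed (closure F)
  closure-closed F x φ (t , ¬f) = ⊢-map-¬¬ {G = λ z χ → F ⊢ z ∶ χ} (λ z ψ _ → closure⁻ {F}) t
    λ t′ → ¬f (closure⁺ {F} λ k → k (⊢-trans (λ _ _ u → u) t′))

  closure-⊑ : ∀ {F c} → Closed c → (∀ x φ → F x φ → ⟦ c ⟧ x φ) → closure F ⊑ c
  closure-⊑ {F} {c} cl p x φ f = closed-∈ {c} cl λ k → closure⁻ {F} f λ t → k (⊢-map (λ z ψ _ → p z ψ) t)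

  ⊑-closure : ∀ {F x φ} → F x φ → ⟦ closure F ⟧ x φ
  ⊑-closure {F} f = closure⁺ {F} λ k → k (⊢-axiom f)

  -- Complexity of closed decorations

  -- Same is an equivalence, and a closed system is a union of its classes; leaders serve as representatives,
  -- so New c j has one element for each class of rank j in c that does not follow from smaller ranks.
  record New (c : Fin S) (j : ℕ) (e : Fin E) : Set where
    constructor new
    field
      member : ⟦ c ⟧ (pt e) (ph e)
      ranked : rk (ph e) ≡ j
      least  : Leader e
      fresh  : ¬ (Below j ⟦ c ⟧ ⊢ pt e ∶ ph e)

  new? : ∀ c j e → Dec (New c j e)
  new? c j e with ⟦ c ⟧? (pt e) (ph e) | rk (ph e) ℕₚ.≟ j | ¬? (smaller? e) | dec¬ (Below j ⟦ c ⟧ ⊢ pt e ∶ ph e)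
  ... | yes p | yes q | yes r | yes s = yes (new p q r s)
  ... | no ¬p | _ | _ | _ = no (¬p ∘ New.member)
  ... | yes _ | no ¬q | _ | _ = no (¬q ∘ New.ranked)
  ... | yes _ | yes _ | no ¬r | _ = no λ w → ¬r (New.least w)
  ... | yes _ | yes _ | yes _ | no ¬s = no λ w → ¬s (New.fresh w)

  level : Fin S → ℕ → ℕ
  level c j = count (new? c j)

  base : ℕ
  base = suc E

  level<base : ∀ c j → level c j <ℕ base
  level<base c j = s≤s (count-≤N (new? c j))

  -- Digits of decreasing weight: where two nested closed systems first differ, the larger one has more new
  -- classes, whatever happens at higher ranks.
  complexity′ : ℕ → Fin S → ℕ
  complexity′ zero    c = 0
  complexity′ (suc j) c = complexity′ j c *ℕ base +ℕ level c j

  complexity′< : ∀ j c → complexity′ j c <ℕ base ^ℕ j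
  complexity′< zero    c = s≤s z≤n
  complexity′< (suc j) c = begin-strict
    complexity′ j c *ℕ base +ℕ level c j <⟨ ℕₚ.+-monoʳ-< (complexity′ j c *ℕ base) (level<base c j) ⟩
    complexity′ j c *ℕ base +ℕ base      ≡⟨ ℕₚ.+-comm (complexity′ j c *ℕ base) base ⟩
    suc (complexity′ j c) *ℕ base        ≤⟨ ℕₚ.*-monoˡ-≤ base (complexity′< j c) ⟩
    base ^ℕ j *ℕ base                    ≡⟨ ℕₚ.*-comm (base ^ℕ j) base ⟩
    base ^ℕ suc j                        ∎
    where open ℕₚ.≤-Reasoning

  module _ {c c′ : Fin S} (cl : Closed c) (cl′ : Closed c′) (c⊑c′ : c ⊑ c′) where

    AgreeBelow : ℕ → Set
    AgreeBelow j = ∀ x φ → rk φ <ℕ j → ⟦ c′ ⟧ x φ → ⟦ c ⟧ x φ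

    below-agree : ∀ {j x φ} → AgreeBelow j → Below j ⟦ c′ ⟧ ⊢ x ∶ φ → Below j ⟦ c ⟧ ⊢ x ∶ φ
    below-agree ag = ⊢-map λ z ψ _ (f , lt) → ag z ψ lt f , lt

    new-agree : ∀ {j} → AgreeBelow j → ∀ e → New c j e → New c′ j e
    new-agree ag e (new p q r s) = new (c⊑c′ _ _ p) q r λ t → s (below-agree ag t)

    Missing : ℕ → Set
    Missing j = ∃ λ e → rk (ph e) ≡ j × ⟦ c′ ⟧ (pt e) (ph e) × ¬ ⟦ c ⟧ (pt e) (ph e)

    missing? : ∀ j → Dec (Missing j)
    missing? j = Finₚ.any? λ e → (rk (ph e) ℕₚ.≟ j) ×-dec (⟦ c′ ⟧? (pt e) (ph e) ×-dec ¬? (⟦ c ⟧? (pt e) (ph e)))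

    agree-suc : ∀ {j} → AgreeBelow j → ¬ Missing j → AgreeBelow (suc j)
    agree-suc ag none x φ lt f with ℕₚ.m<1+n⇒m<n∨m≡n lt
    ... | inj₁ lt′ = ag x φ lt′ f
    ... | inj₂ e   = decidable-stable (⟦ c ⟧? x φ) λ ¬f → none (at x φ , trans (cong rk (ph-at x φ)) e , at⁺ ⟦ c′ ⟧ f , λ g → ¬f (at⁻ ⟦ c ⟧ g))

    level-≡ : ∀ {j} → AgreeBelow j → ¬ Missing j → level c j ≡ level c′ j
    level-≡ {j} ag none = count-cong (new? c j) (new? c′ j) (new-agree ag) λ e (new p q r s) →
      new (decidable-stable (⟦ c ⟧? (pt e) (ph e)) λ ¬f → none (e , q , p , ¬f)) q r
          λ t → s (⊢-map (λ z ψ _ (f , lt) → c⊑c′ z ψ f , lt) t)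

    -- The leader of the missing class is new in `c′`: were it derivable from smaller ranks, where
    -- the two systems agree, closedness would put it into `c`.
    level-< : ∀ {j} → AgreeBelow j → Missing j → level c j <ℕ level c′ j
    level-< {j} ag (e , r , f , ¬f) = count-mono-< (new? c j) (new? c′ j) (new-agree ag) e₀
        (new (closed-same cl′ (same-sym s) f) (trans (same-rk s) r) (proj₁ (proj₂ (leader e)))
          λ t → ¬g (closed-∈ cl λ k → k (⊢-map (λ _ _ _ → proj₁) (below-agree ag t))))
        λ w → ¬g (New.member w)
      where
      e₀ : Fin E
      e₀ = proj₁ (leader e)
      s : SameE e₀ e
      s = proj₂ (proj₂ (leader e))
      ¬g : ¬ ⟦ c ⟧ (pt e₀) (ph e₀)
      ¬g g = ¬f (closed-same cl s g)

    -- Invariant of a lexicographic comparison: either no difference has been seen, or the digits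
    -- read so far already decide for `c′`.
    Compared : ℕ → Set
    Compared j = (AgreeBelow j × complexity′ j c ≡ complexity′ j c′) ⊎ complexity′ j c <ℕ complexity′ j c′

    compared-suc : ∀ j → Compared j → Dec (Missing j) → Compared (suc j)
    -- A digit is smaller than `base`, so it cannot make up for a deficit in the earlier digits.
    compared-suc j (inj₂ lt) _ = inj₂ (begin-strict
      complexity′ j c *ℕ base +ℕ level c j   <⟨ ℕₚ.+-monoʳ-< (complexity′ j c *ℕ base) (level<base c j) ⟩
      complexity′ j c *ℕ base +ℕ base        ≡⟨ ℕₚ.+-comm (complexity′ j c *ℕ base) base ⟩
      suc (complexity′ j c) *ℕ base          ≤⟨ ℕₚ.*-monoˡ-≤ base lt ⟩
      complexity′ j c′ *ℕ base               ≤⟨ ℕₚ.m≤m+n _ _ ⟩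
      complexity′ j c′ *ℕ base +ℕ level c′ j ∎)
      where open ℕₚ.≤-Reasoning
    compared-suc j (inj₁ (ag , eq)) (no none) =
      inj₁ (agree-suc ag none , cong₂ (λ a b → a *ℕ base +ℕ b) eq (level-≡ ag none))
    compared-suc j (inj₁ (ag , eq)) (yes m) =
      inj₂ (ℕₚ.+-mono-≤-< (ℕₚ.≤-reflexive (cong (_*ℕ base) eq)) (level-< ag m))

    compared : ∀ j → Compared j
    compared zero    = inj₁ ((λ x φ ()) , refl)
    compared (suc j) = compared-suc j (compared j) (missing? j)

    complexity′-< : ∀ j → (∀ φ → rk φ <ℕ j) → c ≢ c′ → complexity′ j c <ℕ complexity′ j c′
    complexity′-< j rk<j c≢ = [ (λ (ag , _) → ⊥-elim (c≢ (⊑-antisym c⊑c′ λ x φ → ag x φ (rk<j φ)))) , (λ lt → lt) ]′ (compared j)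

  complexity : Fin S → ℕ
  complexity = complexity′ (suc Code)

  complexity-< : ∀ {c c′} → Closed c → Closed c′ → c ⊑ c′ → c ≢ c′ → complexity c <ℕ complexity c′
  complexity-< cl cl′ p = complexity′-< cl cl′ p (suc Code) λ φ → s≤s (rank≤ (cod φ))

  -- Partial isometries and invariance of complexity

  -- A relation, so that the inverse has the same form. The field `isometric` speaks of two
  -- corresponding sets instead of a set and its image.
  record PartialIso : Set₁ where
    infix 4 _~_
    field
      _~_        : Fin n → Fin n → Set
      ~?         : ∀ x y → Dec (x ~ y)
      functional : ∀ {x y y′} → x ~ y → x ~ y′ → y ≡ y′
      injective  : ∀ {x x′ y} → x ~ y → x′ ~ y → x ≡ x′
      isometric  : ∀ {Z Z′} → (∀ {x} → x ∈ Z → ∃ λ y → y ∈ Z′ × x ~ y) →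
                   (∀ {y} → y ∈ Z′ → ∃ λ x → x ∈ Z × x ~ y) → d Z ≡ d Z′

    Domain : Fin n → Set
    Domain x = ∃ λ y → x ~ y

    domain? : ∀ x → Dec (Domain x)
    domain? x = Finₚ.any? (~? x)

  inverse : PartialIso → PartialIso
  inverse I = record
    { _~_ = λ x y → y ~ x ; ~? = λ x y → ~? y x ; functional = injective ; injective = functional
    ; isometric = λ p q → sym (isometric q p) }
    where open PartialIso I

  record Transports (I : PartialIso) (F F′ : FactSet) : Set where
    open PartialIso I
    field
      dom : ∀ {x φ} → F x φ → ∃ λ y → x ~ y
      rng : ∀ {y φ} → F′ y φ → ∃ λ x → x ~ y
      fwd : ∀ {x y φ} → x ~ y → F x φ → F′ y φ
      bwd : ∀ {x y φ} → x ~ y → F′ y φ → F x φ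

  transports-inverse : ∀ {I F F′} → Transports I F F′ → Transports (inverse I) F′ F
  transports-inverse t = record { dom = rng ; rng = dom ; fwd = bwd ; bwd = fwd }
    where open Transports t

  transports-below : ∀ {I F F′} j → Transports I F F′ → Transports I (Below j F) (Below j F′)
  transports-below j t = record
    { dom = dom ∘ proj₁ ; rng = rng ∘ proj₁
    ; fwd = λ r (f , lt) → fwd r f , lt ; bwd = λ r (f , lt) → bwd r f , lt }
    where open Transports t

  module _ {I : PartialIso} {F F′ : FactSet} (t : Transports I F F′) where
    open PartialIso I
    open Transports t

    -- All premises sit at points of the domain, so the part `Z₀` of `Z` in the domain carries them.
    -- Its image has the same distance, which is at most that of `Z`.
    ⊢-transport : ∀ {x y X c} → x ~ y → Derives F x X c → Derives F′ y X c
    ⊢-transport {x} {y} {X} {c} r (derives {Z} {m} x∈Z ps p) = derives (image⁺ x∈Z r) (go ps)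
        (≼-trans (⊕-monoˡ m (≼-trans (γ-mono-≤ (≤-reflexive (sym (isometric forth back)))) (γ-mono (proj₁ ∘ Z₀⁻)))) p)
      where
      image? : ∀ y → Dec (∃ λ x → x ∈ Z × x ~ y)
      image? y = Finₚ.any? λ x → (x ∈? Z) ×-dec ~? x y
      Z′ : Subset n
      Z′ = comprehension image?
      image⁺ : ∀ {x y} → x ∈ Z → x ~ y → y ∈ Z′
      image⁺ x∈ r = ∈-comprehension⁺ image? (_ , x∈ , r)
      Z₀? : ∀ x → Dec (x ∈ Z × Domain x)
      Z₀? x = (x ∈? Z) ×-dec domain? x
      Z₀ : Subset n
      Z₀ = comprehension Z₀?
      Z₀⁻ : ∀ {x} → x ∈ Z₀ → x ∈ Z × Domain x
      Z₀⁻ = ∈-comprehension⁻ Z₀?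
      forth : ∀ {x} → x ∈ Z₀ → ∃ λ y → y ∈ Z′ × x ~ y
      forth x∈ with Z₀⁻ x∈
      ... | x∈Z , y , r = y , image⁺ x∈Z r , r
      back : ∀ {y} → y ∈ Z′ → ∃ λ x → x ∈ Z₀ × x ~ y
      back {y} y∈ with ∈-comprehension⁻ image? y∈
      ... | x , x∈Z , r = x , ∈-comprehension⁺ Z₀? (x∈Z , y , r) , r
      go : ∀ {W m} → Premises F Z W m → Premises F′ Z′ W m
      go (nil q) = nil q
      go (add z φ f z∈ ps q s) with dom f
      ... | z′ , r′ = add z′ φ (fwd r′ f) (image⁺ z∈ r′) (go ps) q s

    same-transport : ∀ {x y φ ψ x′ y′} → x ~ x′ → y ~ y′ → Same x′ φ y′ ψ → Same x φ y ψ
    same-transport {x} {y} {φ} {ψ} {x′} {y′} r s (same e p q near) = same e p q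
        (≼-trans (⊕-monoˡ (cost φ) (γ-mono-≤ (≤-reflexive (isometric forth back)))) near)
      where
      forth : ∀ {z} → z ∈ ⁅ x ⁆ ∪ ⁅ y ⁆ → ∃ λ z′ → z′ ∈ ⁅ x′ ⁆ ∪ ⁅ y′ ⁆ × z ~ z′
      forth z∈ with x∈p∪q⁻ ⁅ x ⁆ ⁅ y ⁆ z∈
      ... | inj₁ p = x′ , ∈-∪ˡ ⁅ x′ ⁆ ⁅ y′ ⁆ (x∈⁅x⁆ x′) , subst (_~ x′) (sym (x∈⁅y⁆⇒x≡y x p)) r
      ... | inj₂ p = y′ , ∈-∪ʳ ⁅ x′ ⁆ ⁅ y′ ⁆ (x∈⁅x⁆ y′) , subst (_~ y′) (sym (x∈⁅y⁆⇒x≡y y p)) s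
      back : ∀ {z′} → z′ ∈ ⁅ x′ ⁆ ∪ ⁅ y′ ⁆ → ∃ λ z → z ∈ ⁅ x ⁆ ∪ ⁅ y ⁆ × z ~ z′
      back z∈ with x∈p∪q⁻ ⁅ x′ ⁆ ⁅ y′ ⁆ z∈
      ... | inj₁ p = x , ∈-∪ˡ ⁅ x ⁆ ⁅ y ⁆ (x∈⁅x⁆ x) , subst (x ~_) (sym (x∈⁅y⁆⇒x≡y x′ p)) r
      ... | inj₂ p = y , ∈-∪ʳ ⁅ x ⁆ ⁅ y ⁆ (x∈⁅x⁆ y) , subst (y ~_) (sym (x∈⁅y⁆⇒x≡y y′ p)) s

  -- Premises cost no more than the conclusion, so facts of rank below `j` in the closure are
  -- derived from facts of rank below `j`.
  below-closure : ∀ {F j x φ} → Below j ⟦ closure F ⟧ ⊢ x ∶ φ → ¬ ¬ (Below j F ⊢ x ∶ φ)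
  below-closure {F} {j} t k = ⊢-map-¬¬ {G = λ z χ → Below j F ⊢ z ∶ χ}
    (λ z ψ _ (f , lt) k′ → closure⁻ {F} f λ u →
      k′ (⊢-map (λ w χ p g → g , ℕₚ.≤-<-trans (rank-mono (cod χ) (cod ψ) p) lt) u)) t
    λ t′ → k (⊢-trans (λ _ _ u → u) t′)

  below-closure⁺ : ∀ {F j x φ} → Below j F ⊢ x ∶ φ → Below j ⟦ closure F ⟧ ⊢ x ∶ φ
  below-closure⁺ {F} = ⊢-map λ z ψ _ (f , lt) → ⊑-closure {F} f , lt

  -- A new fact in the closure of F has the same cost as a premise of its derivation,
  -- so it is the same as a fact at a point of F.
  new-origin : ∀ {F j e} → New (closure F) j e → ¬ ¬ ∃ λ z → (∃ λ φ → F z φ) × Same (pt e) (ph e) z (ph e)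
  new-origin {F} {j} {e} (new p q r s) k = closure⁻ {F} p λ (derives {Z} {m} x∈ ps le) →
    origin Z m x∈ le (premises-split (cod (ph e)) ps (≼-trans ≼⊕ʳ le))
    where
    origin : ∀ Z m → pt e ∈ Z → γ Z ⊕ m ≼ cost (ph e) → _ → Data.Empty.⊥
    origin Z m x∈ le (inj₁ ps) = s (below-closure⁺ {F} (subst (λ j → Below j F ⊢ pt e ∶ ph e) q (derives x∈ ps le)))
    origin Z m x∈ le (inj₂ (z , φ , f , z∈ , φ≼m , e≼φ)) = k (z , (φ , f) , same refl ≼-refl ≼-refl
      (≼-trans (⊕-mono (γ-mono (∪-⊆ (⁅⁆-⊆ x∈) (⁅⁆-⊆ z∈))) (≼-trans e≼φ φ≼m)) le))

  module _ {I : PartialIso} {F F′ : FactSet} (t : Transports I F F′) where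
    open PartialIso I
    open Transports t

    -- The fact moves to the point `z` of the domain, then along the isometry, then to its leader.
    -- It stays fresh, as a derivation from smaller ranks could be carried back the same way.
    new-transport : ∀ {j e z z′} → New (closure F) j e → Same (pt e) (ph e) z (ph e) → z ~ z′ →
                    ∃ λ e′ → New (closure F′) j e′ × SameE e′ (at z′ (ph e))
    new-transport {j} {e} {z} {z′} (new p q r s) sm z~z′ with leader (at z′ (ph e))
    ... | e′ , ld , sm′ = e′ , new member (trans (same-rk sm′) (trans (cong rk (ph-at z′ (ph e))) q)) ld fresh , sm′
      where
      sm″ : Same (pt e′) (ph e′) z′ (ph e)
      sm″ = at⁻ (Same (pt e′) (ph e′)) sm′
      member : ⟦ closure F′ ⟧ (pt e′) (ph e′)
      member = closed-same (closure-closed F′) (same-sym sm″) (closure⁺ {F′} λ k →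
        closure⁻ {F} (closed-same (closure-closed F) sm p) λ u → k (⊢-transport t z~z′ u))
      fresh : ¬ (Below j ⟦ closure F′ ⟧ ⊢ pt e′ ∶ ph e′)
      fresh u = below-closure {F′} u λ u′ → s (below-closure⁺ {F}
        (same-⊢′ (same-sym sm) (⊢-transport (transports-inverse (transports-below j t)) z~z′ (same-⊢′ sm″ u′))))

    Twin : Fin E → Fin E → Set
    Twin e e′ = ∃ λ z → ∃ λ z′ → z ~ z′ × Same (pt e) (ph e) z (ph e) × Same (pt e′) (ph e′) z′ (ph e)

    Link : ℕ → Fin E → Fin E → Set
    Link j e e′ = New (closure F) j e × New (closure F′) j e′ × ¬ ¬ Twin e e′

    link? : ∀ j e e′ → Dec (Link j e e′)
    link? j e e′ = new? (closure F) j e ×-dec (new? (closure F′) j e′ ×-dec dec¬ (¬ Twin e e′))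

    link-total : ∀ j e → New (closure F) j e → ¬ ¬ ∃ (Link j e)
    link-total j e w k = new-origin {F} w λ (z , (φ , f) , sm) → found z sm (dom f)
      where
      found : ∀ z → Same (pt e) (ph e) z (ph e) → Domain z → Data.Empty.⊥
      found z sm (z′ , r) = let (e′ , w′ , sm′) = new-transport w sm r in
        k (e′ , w , w′ , λ k′ → k′ (z , z′ , r , sm , at⁻ (Same (pt e′) (ph e′)) sm′))

    twin-injective : ∀ {e₁ e₂ e′} → Twin e₁ e′ → Twin e₂ e′ → SameE e₁ e₂
    twin-injective (z₁ , z₁′ , r₁ , s₁ , s₁′) (z₂ , z₂′ , r₂ , s₂ , s₂′) =
      same-trans s₁ (same-trans (same-transport t r₁ r₂ (same-trans (same-sym s₁′) s₂′)) (same-sym s₂))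

    link-injective : ∀ j e₁ e₂ e′ → Link j e₁ e′ → Link j e₂ e′ → e₁ ≡ e₂
    link-injective j e₁ e₂ e′ (w₁ , _ , tw₁) (w₂ , _ , tw₂) = decidable-stable (e₁ ≟ e₂) λ k →
      tw₁ λ tw → tw₂ λ tw′ → k (leader-unique {e₁} {e₂} (New.least w₁) (New.least w₂) (twin-injective {e₁} {e₂} {e′} tw tw′))

    level-transport : ∀ j → level (closure F) j ≤ℕ level (closure F′) j
    level-transport j = count-≤-by {P = New (closure F) j} {Q = New (closure F′) j} {R = Link j}
      (new? (closure F) j) (new? (closure F′) j) (link? j) (link-total j) (λ e e′ l → proj₁ (proj₂ l)) (link-injective j)

  -- The closures may extend beyond domain and range, where nothing matches them. But new facts
  -- originate at points of `F`, so every digit is invariant; the isometry and its inverse give the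
  -- two inequalities.
  complexity-transport : ∀ {I F F′} → Transports I F F′ → complexity (closure F) ≡ complexity (closure F′)
  complexity-transport {I} {F} {F′} t = go (suc Code)
    where
    go : ∀ j → complexity′ j (closure F) ≡ complexity′ j (closure F′)
    go zero    = refl
    go (suc j) = cong₂ (λ a b → a *ℕ base +ℕ b) (go j)
      (ℕₚ.≤-antisym (level-transport t j) (level-transport (transports-inverse t) j))

  -- Weights of closed decorations by Möbius inversion

  K : ℕ
  K = suc S

  -- Each closed system outweighs all larger ones together, which keeps the Möbius inverse of mass positive.
  mass : Fin S → ℕ
  mass c = K ^ℕ (base ^ℕ suc Code ∸ complexity c)

  open Möbius {S} {_⊑_} _⊑?_ ⊑-refl absent absent-<
  open Inversion {Closed} closed? mass

  -- The exponents differ by at least one, since complexity is strictly monotone and stays below the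
  -- number it is subtracted from.
  mass-K : ∀ {p q} → Closed p → Closed q → p ⊑ q → p ≢ q → mass q *ℕ K ≤ℕ mass p
  mass-K {p} {q} clp clq p⊑q p≢q = ℕₚ.≤-trans (ℕₚ.≤-reflexive (ℕₚ.*-comm (mass q) K))
    (ℕₚ.^-monoʳ-≤ K (ℕₚ.∸-monoʳ-< (complexity-< clp clq p⊑q p≢q) (ℕₚ.<⇒≤ (complexity′< (suc Code) q))))

  -- At most `S` closed decorations lie above `p`, each lighter by a factor of at least `K`, which
  -- is `suc S`. Multiplying by `K` avoids division.
  above<mass : ∀ p → Closed p → above restricted p <ℕ mass p
  above<mass p cl = ℕₚ.*-cancelʳ-< K (above restricted p) (mass p) (begin-strict
    above restricted p *ℕ K                                ≡⟨ *-distribʳ-sum K (λ q → 𝟙 (p ⊏? q) *ℕ restricted q) ⟩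
    sum (λ q → 𝟙 (p ⊏? q) *ℕ restricted q *ℕ K)            ≤⟨ sum-const-≤ small ⟩
    S *ℕ mass p                                            <⟨ ℕₚ.*-monoˡ-< (mass p) {{ℕ.>-nonZero (ℕₚ.m^n>0 K (base ^ℕ suc Code ∸ complexity p))}} (ℕₚ.n<1+n S) ⟩
    K *ℕ mass p                                            ≡⟨ ℕₚ.*-comm K (mass p) ⟩
    mass p *ℕ K                                            ∎)
    where
    open ℕₚ.≤-Reasoning
    small : ∀ q → 𝟙 (p ⊏? q) *ℕ restricted q *ℕ K ≤ℕ mass p
    small q with p ⊏? q | closed? q
    ... | no _ | _ = z≤n
    ... | yes _ | no _ = z≤n
    ... | yes (p⊑q , p≢q) | yes clq = ℕₚ.≤-trans
          (ℕₚ.≤-reflexive (cong (_*ℕ K) (trans (ℕₚ.*-identityˡ _) (ℕₚ.*-identityˡ (mass q))))) (mass-K cl clq p⊑q p≢q)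

  weight-closed : ∀ c → 0 <ℕ weight c → Closed c
  weight-closed c 0< = decidable-stable (closed? c) λ ¬cl → ℕₚ.<-irrefl (sym (weight-outside c ¬cl)) 0<

  closed-weight : ∀ c → Closed c → 0 <ℕ weight c
  closed-weight c cl = weight-positive c cl (above<mass c cl)

  weighted-cong : ∀ {P Q : Fin S → Set} (P? : Decidable₁ P) (Q? : Decidable₁ Q) →
                  (∀ c → Closed c → P c → Q c) → (∀ c → Closed c → Q c → P c) →
                  sum (λ c → 𝟙 (P? c) *ℕ weight c) ≡ sum (λ c → 𝟙 (Q? c) *ℕ weight c)
  weighted-cong P? Q? f g = sum-cong-≗ λ c → pointwise c (closed? c)
    where
    pointwise : ∀ c → Dec (Closed c) → 𝟙 (P? c) *ℕ weight c ≡ 𝟙 (Q? c) *ℕ weight c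
    pointwise c (yes cl) = cong (_*ℕ weight c) (𝟙-cong (P? c) (Q? c) (f c cl) (g c cl))
    pointwise c (no ¬cl) = trans (trans (cong (𝟙 (P? c) *ℕ_) (weight-outside c ¬cl)) (ℕₚ.*-zeroʳ (𝟙 (P? c))))
                    (sym (trans (cong (𝟙 (Q? c) *ℕ_) (weight-outside c ¬cl)) (ℕₚ.*-zeroʳ (𝟙 (Q? c)))))

  -- A closed decoration contains `p` exactly when it contains the closure of `p`, and at closed
  -- decorations the inversion is exact.
  up-weight-closure : ∀ p → up weight p ≡ mass (closure ⟦ p ⟧)
  up-weight-closure p = trans
    (weighted-cong (p ⊑?_) (closure ⟦ p ⟧ ⊑?_)
      (λ c cl → closure-⊑ {⟦ p ⟧} {c} cl) (λ c cl q x φ f → q x φ (⊑-closure {⟦ p ⟧} f)))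
    (up-weight (closure ⟦ p ⟧) (closure-closed ⟦ p ⟧) (ℕₚ.<⇒≤ (above<mass _ (closure-closed ⟦ p ⟧))))

  -- Pullbacks of decorations and the multiset of coordinates

  module _ (I : PartialIso) where
    open PartialIso I

    pull? : ∀ c x φ → Dec (∃ λ y → x ~ y × ⟦ c ⟧ y φ)
    pull? c x φ = Finₚ.any? λ y → ~? x y ×-dec ⟦ c ⟧? y φ

    abstract
      -- For a partial identity this is restriction to the domain.
      pull : Fin S → Fin S
      pull c = system (pull? c)

      pull⁺ : ∀ {c x y φ} → x ~ y → ⟦ c ⟧ y φ → ⟦ pull c ⟧ x φ
      pull⁺ {c} r f = system⁺ (pull? c) (_ , r , f)

      pull⁻ : ∀ {c x φ} → ⟦ pull c ⟧ x φ → ∃ λ y → x ~ y × ⟦ c ⟧ y φ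
      pull⁻ {c} = system⁻ (pull? c)

    Supported : Fin S → Set
    Supported p = ∀ x φ → ⟦ p ⟧ x φ → Domain x

    pull-unsupported : ∀ p → ¬ Supported p → sum (λ c → 𝟙 (p ⊑? pull c) *ℕ weight c) ≡ 0
    pull-unsupported p ¬s = sum-zero λ c → cong (_*ℕ weight c) (𝟙-false (p ⊑? pull c)
      λ q → ¬s λ x φ f → let (y , r , _) = pull⁻ (q x φ f) in y , r)

    -- By adjunction, `p ⊑ pull c` says that `c` contains the push-forward of `p`, whose closure is
    -- as complex as that of `p`. Thus the value does not depend on the isometry.
    pull-mass : ∀ p → Supported p → sum (λ c → 𝟙 (p ⊑? pull c) *ℕ weight c) ≡ mass (closure ⟦ p ⟧)
    pull-mass p supp = trans (weighted-cong (λ c → p ⊑? pull c) (push ⊑?_) to from)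
      (trans (up-weight-closure push) (cong (λ h → K ^ℕ (base ^ℕ suc Code ∸ h)) (sym (complexity-transport moved))))
      where
      push? : ∀ y φ → Dec (∃ λ x → x ~ y × ⟦ p ⟧ x φ)
      push? y φ = Finₚ.any? λ x → ~? x y ×-dec ⟦ p ⟧? x φ
      push : Fin S
      push = system push?
      to : ∀ c → Closed c → p ⊑ pull c → push ⊑ c
      to c _ q y φ f with system⁻ push? f
      ... | x , r , g with pull⁻ (q x φ g)
      ...   | y′ , r′ , h = subst (λ z → ⟦ c ⟧ z φ) (functional r′ r) h
      from : ∀ c → Closed c → push ⊑ c → p ⊑ pull c
      from c _ q x φ f with supp x φ f
      ... | y , r = pull⁺ r (q y φ (system⁺ push? (x , r , f)))
      moved : Transports I ⟦ p ⟧ ⟦ push ⟧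
      moved = record
        { dom = supp _ _
        ; rng = λ f → let (x , r , _) = system⁻ push? f in x , r
        ; fwd = λ r f → system⁺ push? (_ , r , f)
        ; bwd = λ r f → let (x , r′ , g) = system⁻ push? f in subst (λ z → ⟦ p ⟧ z _) (injective r′ r) g }

    supported? : ∀ p → Dec (Supported p)
    supported? p = Finₚ.all? λ x → Finₚ.all? λ φ → ⟦ p ⟧? x φ →-dec domain? x

    pull-⟨⟩ : ∀ {c x y} → x ~ y → pull c ⟨ x ⟩ ≡ c ⟨ y ⟩
    pull-⟨⟩ {c} {x} {y} r = ∋-ext
      (λ φ f → let (y′ , r′ , g) = pull⁻ f in subst (λ z → ⟦ c ⟧ z φ) (functional r′ r) g)
      (λ φ f → pull⁺ r f)

  open PartialIso using (Domain)

  abstract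
    M : ℕ
    M = sum weight

    κ : Fin M → Fin S
    κ = enumerate weight

    count-κ : {P : Fin S → Set} (P? : Decidable₁ P) → count (λ i → P? (κ i)) ≡ sum λ c → 𝟙 (P? c) *ℕ weight c
    count-κ = count-enumerate weight

    κ-closed : ∀ i → Closed (κ i)
    κ-closed i = weight-closed (κ i) (enumerate-positive weight i)

    κ-surjective : ∀ c → Closed c → ∃ λ i → κ i ≡ c
    κ-surjective c cl = enumerate-surjective weight c (closed-weight c cl)

  open Matching {M} {S}

  -- On every principal upper set both distributions have a mass that depends on the common domain
  -- only: that of a closure, or zero if `p` has facts outside the domain. Möbius inversion then
  -- identifies them.
  pull-fibres : ∀ I J → (∀ x → Domain I x → Domain J x) → (∀ x → Domain J x → Domain I x) →
                SameFibres (pull I ∘ κ) (pull J ∘ κ)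
  pull-fibres I J f g s = begin
    count (λ i → pull I (κ i) ≟ s)               ≡⟨ count-κ (λ c → pull I c ≟ s) ⟩
    sum (λ c → 𝟙 (pull I c ≟ s) *ℕ weight c)     ≡⟨ sum-cong-≗ (λ c → cong (_*ℕ weight c) (𝟙-cong (pull I c ≟ s) (s ≟ pull I c) sym sym)) ⟩
    pushforward weight (pull I) s                ≡⟨ pushforward-≡ weight (pull I) (pull J) (λ p → equal p (supported? I p)) s ⟩
    pushforward weight (pull J) s                ≡⟨ sum-cong-≗ (λ c → cong (_*ℕ weight c) (𝟙-cong (s ≟ pull J c) (pull J c ≟ s) sym sym)) ⟩
    sum (λ c → 𝟙 (pull J c ≟ s) *ℕ weight c)     ≡⟨ count-κ (λ c → pull J c ≟ s) ⟨
    count (λ i → pull J (κ i) ≟ s)               ∎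
    where
    open ≡-Reasoning
    equal : ∀ p → Dec (Supported I p) → sum (λ c → 𝟙 (p ⊑? pull I c) *ℕ weight c) ≡ sum (λ c → 𝟙 (p ⊑? pull J c) *ℕ weight c)
    equal p (yes supp) = trans (pull-mass I p supp) (sym (pull-mass J p λ x φ h → f x (supp x φ h)))
    equal p (no ¬supp) = trans (pull-unsupported I p ¬supp) (sym (pull-unsupported J p λ supp → ¬supp λ x φ h → g x (supp x φ h)))

  -- The decoration that records the distances of A

  initial? : ∀ x φ → Dec (γ (lbl φ ∪ ⁅ x ⁆) ≼ cost φ)
  initial? x φ = ≼-dec (γ (lbl φ ∪ ⁅ x ⁆)) (cost φ)

  -- All facts that are true in `A`, in the sense that the cost covers the distance of the label
  -- with `x` added. Its coordinate detects the original distance.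
  initial : Fin S
  initial = system initial?

  initial-premises : ∀ {Z W m x} → x ∈ Z → Premises ⟦ initial ⟧ Z W m → γ (W ∪ Z) ≼ γ Z ⊕ m
  initial-premises x∈ (nil q) = ≼-trans (γ-mono (∪-⊆ (λ p → ⊥-elim (∉⊥ (q p))) ⊆-refl)) ≼⊕ˡ
  initial-premises {Z} {W} {m} x∈ (add {W = W₁} {m = m₁} z φ f z∈ ps q r) =
    ≼-trans (γ-join (∈-∪ʳ (lbl φ) ⁅ z ⁆ (x∈⁅x⁆ z)) (∈-∪ʳ W₁ Z z∈)
              (∪-⊆ (⊆-trans q (∪-mono (p⊆p∪q ⁅ z ⁆) (p⊆p∪q Z))) (⊆-trans (q⊆p∪q W₁ Z) (q⊆p∪q (lbl φ ∪ ⁅ z ⁆) (W₁ ∪ Z)))))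
    (≼-trans (⊕-mono (system⁻ initial? f) (initial-premises x∈ ps))
    (≼-trans (⊕-swap-≼ (cost φ) (γ Z) m₁) (⊕-mono ≼-refl r)))

  initial-closed : Closed initial
  initial-closed x φ (derives {Z} x∈ ps le , ¬f) = ¬f (system⁺ initial?
    (≼-trans (γ-mono (∪-mono ⊆-refl (⁅⁆-⊆ x∈))) (≼-trans (initial-premises x∈ ps) le)))

  i₀ : Fin M
  i₀ = proj₁ (κ-surjective initial initial-closed)

  κ-i₀ : κ i₀ ≡ initial
  κ-i₀ = proj₂ (κ-surjective initial initial-closed)

  initial-point : ∀ x → ⟦ initial ⟧ x (fact ⁅ x ⁆ 𝟘)
  initial-point x = system⁺ initial? (≼-trans (subst (λ W → γ (W ∪ ⁅ x ⁆) ≼ 𝟘) (sym (lbl-fact ⁅ x ⁆ 𝟘)) (γ-pair-self x)) 𝟘≼)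

  -- The points of B and their distance

  abstract
    m : ℕ
    m = T ^ℕ M

    infix 9 _[_]
    _[_] : Fin m → Fin M → Fin T
    b [ i ] = finToFun {T} {M} b i

    point : (Fin M → Fin T) → Fin m
    point f = funToFin f

    point-[] : ∀ f i → point f [ i ] ≡ f i
    point-[] f i = Finₚ.finToFun-funToFin f i

    []-ext : ∀ {b b′} → (∀ i → b [ i ] ≡ b′ [ i ]) → b ≡ b′
    []-ext {b} {b′} = finToFun-injective {M} {T} b b′

  -- The constructor `ceiling` makes every set connectable, so that the infimum exists and the
  -- distances in `B` are bounded.
  data Connects (t : Fin T) (W : Subset n) : ℝ → Set where
    ceiling : Connects t W (d ⊤)
    via     : ∀ {φ z} → t ∋ φ → W ⊆ lbl φ → cost φ ≼ z → Connects t W (total z)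

  abstract
    hat′ : ∀ t W → Infimum (Connects t W)
    hat′ t W = infimum (Connects t W) (d ⊤ , ceiling) (0ℝ , below-all)
      where
      below-all : ∀ y → Connects t W y → 0ℝ ≤ y
      below-all _ ceiling           = nonneg ⊤
      below-all _ (via {z = z} _ _ _) = total-nonneg z

    hat : Fin T → Subset n → ℝ
    hat t W = proj₁ (hat′ t W)

    hat≤ : ∀ {t W y} → Connects t W y → hat t W ≤ y
    hat≤ {t} {W} p = proj₁ (proj₂ (hat′ t W)) _ p

    ≤hat : ∀ {t W v} → (∀ y → Connects t W y → v ≤ y) → v ≤ hat t W
    ≤hat {t} {W} = proj₂ (proj₂ (hat′ t W)) _

    η-exists : ∃ λ η → 0ℝ ≤ η × η ≢ 0ℝ × (∀ X → ¬ ∣ X ∣ ≤ℕ 1 → η ≤ d X)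
    η-exists = let (η , p , q , r) = positive-lower-bound (value ∘ subsetOf) (λ i → value≥0 (subsetOf i)) (λ i → value≢0 (subsetOf i)) in
      η , p , q , λ X X≰1 → ≤-trans (subst (λ Y → η ≤ value Y) (subsetOf-label X) (r (label X))) (value≤ X X≰1)
      where
      value : Subset n → ℝ
      -- Sets with at most one point get an arbitrary positive default; the bound is wanted for the
      -- larger ones.
      value X = [ (λ _ → proj₁ positive) , (λ _ → d X) ]′ (toSum (∣ X ∣ ℕₚ.≤? 1))
      value≥0 : ∀ X → 0ℝ ≤ value X
      value≥0 X with ∣ X ∣ ℕₚ.≤? 1
      ... | yes _ = proj₁ (proj₂ positive)
      ... | no _  = nonneg X
      value≢0 : ∀ X → value X ≢ 0ℝ
      value≢0 X with ∣ X ∣ ℕₚ.≤? 1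
      ... | yes _ = proj₂ (proj₂ positive)
      ... | no ¬p = ¬p ∘ proj₁ (zero-iff X)
      value≤ : ∀ X → ¬ ∣ X ∣ ≤ℕ 1 → value X ≤ d X
      value≤ X X≰1 with ∣ X ∣ ℕₚ.≤? 1
      ... | yes p = ⊥-elim (X≰1 p)
      ... | no _  = ≤-refl

  η : ℝ
  η = proj₁ η-exists

  -- In coordinate i, the points of X jointly connect to W at cost r.
  data Reach (X : Subset m) (i : Fin M) : Subset n → ℝ → Set where
    nil : ∀ {W r} → W ⊆ ⊥ → 0ℝ ≤ r → Reach X i W r
    add : ∀ {W W′ r r′ b φ z} → b ∈ X → (b [ i ]) ∋ φ → cost φ ≼ z → Reach X i W r →
          W′ ⊆ lbl φ ∪ W → total z + r ≤ r′ → Reach X i W′ r′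

  reach-nonneg : ∀ {X i W r} → Reach X i W r → 0ℝ ≤ r
  reach-nonneg (nil _ p) = p
  reach-nonneg (add {z = z} _ _ _ ρ _ p) = ≤-trans (0≤+ (total-nonneg z) (reach-nonneg ρ)) p

  reach-map : ∀ {X X′ i i′ W r} → (∀ {b} → b ∈ X → ∃ λ b′ → b′ ∈ X′ × b [ i ] ≡ b′ [ i′ ]) →
              Reach X i W r → Reach X′ i′ W r
  reach-map h (nil p q) = nil p q
  reach-map h (add {φ = φ} b∈ f p ρ q s) with h b∈
  ... | b′ , b′∈ , e = add b′∈ (subst (_∋ φ) e f) p (reach-map h ρ) q s

  reach-split : ∀ {X Z i W r} → Reach (X ∪ Z) i W r → ∃ λ W₁ → ∃ λ W₂ → ∃ λ r₁ → ∃ λ r₂ →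
                Reach X i W₁ r₁ × Reach Z i W₂ r₂ × W ⊆ W₁ ∪ W₂ × r₁ + r₂ ≤ r
  reach-split (nil p q) = ⊥ , ⊥ , 0ℝ , 0ℝ , nil ⊆-refl ≤-refl , nil ⊆-refl ≤-refl ,
    (λ x → ⊥-elim (∉⊥ (p x))) , ≤-trans (≤-reflexive (+-identityˡ 0ℝ)) q
  reach-split {X} {Z} (add {φ = φ} {z = z} b∈ f p ρ q s) with reach-split {X} {Z} ρ | x∈p∪q⁻ X Z b∈
  ... | W₁ , W₂ , r₁ , r₂ , ρ₁ , ρ₂ , u , v | inj₁ b∈X =
    lbl φ ∪ W₁ , W₂ , total z + r₁ , r₂ , add b∈X f p ρ₁ ⊆-refl ≤-refl , ρ₂ ,
    ⊆-trans q (∪-⊆ (⊆-trans (p⊆p∪q W₁) (p⊆p∪q W₂)) (⊆-trans u (∪-mono (q⊆p∪q (lbl φ) W₁) ⊆-refl))) ,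
    ≤-trans (≤-reflexive (+-assoc _ _ _)) (≤-trans (+-mono-≤ ≤-refl v) s)
  ... | W₁ , W₂ , r₁ , r₂ , ρ₁ , ρ₂ , u , v | inj₂ b∈Z =
    W₁ , lbl φ ∪ W₂ , r₁ , total z + r₂ , ρ₁ , add b∈Z f p ρ₂ ⊆-refl ≤-refl ,
    ⊆-trans q (∪-⊆ (⊆-trans (p⊆p∪q W₂) (q⊆p∪q W₁ (lbl φ ∪ W₂))) (⊆-trans u (∪-mono ⊆-refl (q⊆p∪q (lbl φ) W₂)))) ,
    ≤-trans (≤-reflexive (+-swap r₁ (total z) r₂))
      (≤-trans (+-mono-≤ ≤-refl v) s)

  -- The δ X defined below has to satisfy hat (b [ i ]) W ≤ δ X + r whenever X reaches W at cost r;
  -- the floor η separates points whose coordinates connect to every set at equal costs.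
  data Gap (X : Subset m) (y : ℝ) : Set where
    none  : y ≡ 0ℝ → Gap X y
    floor : ¬ ∣ X ∣ ≤ℕ 1 → y ≡ η → Gap X y
    gap   : ∀ {i b W r} → ¬ ∣ X ∣ ≤ℕ 1 → b ∈ X → Reach X i W r → y + r ≤ hat (b [ i ]) W → Gap X y

  abstract
    δ′ : ∀ X → Supremum (Gap X)
    δ′ X = sup (Gap X) (0ℝ , none refl) (d ⊤ + η , bound≤)
      where
      bound≤ : ∀ y → Gap X y → y ≤ d ⊤ + η
      bound≤ y (none refl) = 0≤+ (nonneg ⊤) (proj₁ (proj₂ η-exists))
      bound≤ y (floor _ refl) = x≤y+x (nonneg ⊤)
      bound≤ y (gap _ _ ρ p) = ≤-trans (x≤x+y (reach-nonneg ρ)) (≤-trans p (≤-trans (hat≤ ceiling) (x≤x+y (proj₁ (proj₂ η-exists)))))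

    δ : Subset m → ℝ
    δ X = proj₁ (δ′ X)

    δ-nonneg : ∀ X → 0ℝ ≤ δ X
    δ-nonneg X = proj₁ (proj₂ (δ′ X)) 0ℝ (none refl)

    η≤δ : ∀ X → ¬ ∣ X ∣ ≤ℕ 1 → η ≤ δ X
    η≤δ X p = proj₁ (proj₂ (δ′ X)) η (floor p refl)

    hat≤δ : ∀ {X i b W r} → ¬ ∣ X ∣ ≤ℕ 1 → b ∈ X → Reach X i W r → hat (b [ i ]) W ≤ δ X + r
    hat≤δ {X} {i} {b} {W} {r} p b∈ ρ = -≤⇒≤+ (proj₁ (proj₂ (δ′ X)) _ (gap p b∈ ρ (≤-reflexive (-+-cancelʳ _ r))))

    δ≤ : ∀ {X v} → 0ℝ ≤ v → (¬ ∣ X ∣ ≤ℕ 1 → η ≤ v) →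
         (∀ {i b W r} → ¬ ∣ X ∣ ≤ℕ 1 → b ∈ X → Reach X i W r → hat (b [ i ]) W ≤ v + r) → δ X ≤ v
    δ≤ {X} {v} p q s = proj₂ (proj₂ (δ′ X)) v λ where
      y (none refl)     → p
      y (floor h refl)  → q h
      y (gap {r = r} h b∈ ρ t) → subst (_≤ v) (+-cancelʳ y r) (≤+⇒-≤ (≤-trans t (s h b∈ ρ)))

  -- Reaching happens within a single coordinate, so coordinates may be renamed by `c`, and points
  -- may be replaced separately in each. The identity as `c` gives monotonicity, a permutation gives
  -- invariance.
  δ-≤-by : ∀ {X X′} → (∣ X′ ∣ ≤ℕ 1 → ∣ X ∣ ≤ℕ 1) → (c : Fin M → Fin M) →
           (∀ i {b} → b ∈ X → ∃ λ b′ → b′ ∈ X′ × b [ i ] ≡ b′ [ c i ]) → δ X ≤ δ X′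
  δ-≤-by {X} {X′} size c h = δ≤ (δ-nonneg X′) (λ p → η≤δ X′ (p ∘ size)) moved
    where
    moved : ∀ {i b W r} → ¬ ∣ X ∣ ≤ℕ 1 → b ∈ X → Reach X i W r → hat (b [ i ]) W ≤ δ X′ + r
    moved {i} {b} {W} {r} p b∈ ρ with h i b∈
    ... | b′ , b′∈ , e = subst (λ t → hat t W ≤ δ X′ + r) (sym e) (hat≤δ (p ∘ size) b′∈ (reach-map (h i) ρ))

  δ-mono : ∀ {X X′} → X ⊆ X′ → δ X ≤ δ X′
  δ-mono p = δ-≤-by (ℕₚ.≤-trans (p⊆q⇒∣p∣≤∣q∣ p)) (λ i → i) λ i {b} b∈ → b , p b∈ , refl

  δ-zero : ∀ X → ∣ X ∣ ≤ℕ 1 → δ X ≡ 0ℝ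
  δ-zero X p = ≤-antisym (δ≤ ≤-refl (λ q → ⊥-elim (q p)) (λ q → ⊥-elim (q p))) (δ-nonneg X)

  δ-zero⁻ : ∀ X → δ X ≡ 0ℝ → ∣ X ∣ ≤ℕ 1
  δ-zero⁻ X e = decidable-stable (∣ X ∣ ℕₚ.≤? 1) λ q → proj₁ (proj₂ (proj₂ η-exists))
    (≤-antisym (subst (η ≤_) e (η≤δ X q)) (proj₁ (proj₂ η-exists)))

  -- The common point `g` mediates: it connects to `W₂` at cost at most `δ V + r₂`, and adding such
  -- a connection to what `U` reaches lets `b` connect to `W`.
  hat≤δ+δ : ∀ {U V g b i W W₁ W₂ r₁ r₂} → ¬ ∣ U ∣ ≤ℕ 1 → ¬ ∣ V ∣ ≤ℕ 1 → g ∈ U → g ∈ V → b ∈ U →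
            Reach U i W₁ r₁ → Reach V i W₂ r₂ → W ⊆ W₁ ∪ W₂ → hat (b [ i ]) W ≤ (δ U + δ V) + (r₁ + r₂)
  hat≤δ+δ {U} {V} {g} {b} {i} {W} {W₁} {W₂} {r₁} {r₂} p q g∈U g∈V b∈ ρ₁ ρ₂ W⊆ = begin
    hat (b [ i ]) W                      ≤⟨ -≤⇒≤+ (≤hat below) ⟩
    hat (g [ i ]) W₂ + (δ U + r₁)        ≤⟨ +-mono-≤ (hat≤δ q g∈V ρ₂) ≤-refl ⟩
    (δ V + r₂) + (δ U + r₁)              ≡⟨ +-rearrange (δ V) r₂ (δ U) r₁ ⟩
    (δ U + δ V) + (r₁ + r₂)              ∎
    where
    open ≤-Reasoning
    below : ∀ y → Connects (g [ i ]) W₂ y → hat (b [ i ]) W + (- (δ U + r₁)) ≤ y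
    -- The ceiling is not a fact and cannot be added to what `U` reaches, but `b` is subject to the
    -- same ceiling.
    below _ ceiling = ≤+⇒-≤ (≤-trans (hat≤ ceiling) (x≤x+y (0≤+ (δ-nonneg U) (reach-nonneg ρ₁))))
    below _ (via {φ} {z} f W₂⊆ le) = ≤+⇒-≤ (begin
      hat (b [ i ]) W          ≤⟨ hat≤δ p b∈ (add g∈U f le ρ₁ (⊆-trans W⊆ (∪-⊆ (q⊆p∪q (lbl φ) W₁) (⊆-trans W₂⊆ (p⊆p∪q W₁)))) ≤-refl) ⟩
      δ U + (total z + r₁)     ≡⟨ +-swap (δ U) (total z) r₁ ⟩
      total z + (δ U + r₁)     ∎)

  δ-triangle : ∀ X Y Z → Nonempty Y → δ (X ∪ Z) ≤ δ (X ∪ Y) + δ (Y ∪ Z)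
  δ-triangle X Y Z (g , g∈Y) with ∣ X ∪ Y ∣ ℕₚ.≤? 1 | ∣ Y ∪ Z ∣ ℕₚ.≤? 1
  -- If `X ∪ Y` has at most one point, then `X ⊆ Y` and monotonicity suffices.
  ... | yes small | _ = ≤-trans (δ-mono (∪-⊆ (λ x∈ → ∈-∪ˡ Y Z
          (subst (_∈ Y) (∣X∣≤1⇒atMostOne (X ∪ Y) small (∈-∪ʳ X Y g∈Y) (∈-∪ˡ X Y x∈)) g∈Y)) (q⊆p∪q Y Z))) (x≤y+x (δ-nonneg (X ∪ Y)))
  ... | no _ | yes small = ≤-trans (δ-mono (∪-⊆ (p⊆p∪q Y) (λ z∈ → ∈-∪ʳ X Y
          (subst (_∈ Y) (∣X∣≤1⇒atMostOne (Y ∪ Z) small (∈-∪ˡ Y Z g∈Y) (∈-∪ʳ Y Z z∈)) g∈Y)))) (x≤x+y (δ-nonneg (Y ∪ Z)))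
  ... | no large | no large′ = δ≤ (0≤+ (δ-nonneg (X ∪ Y)) (δ-nonneg (Y ∪ Z)))
          (λ _ → ≤-trans (η≤δ (X ∪ Y) large) (x≤x+y (δ-nonneg (Y ∪ Z)))) main
    where
    main : ∀ {i b W r} → ¬ ∣ X ∪ Z ∣ ≤ℕ 1 → b ∈ X ∪ Z → Reach (X ∪ Z) i W r →
           hat (b [ i ]) W ≤ (δ (X ∪ Y) + δ (Y ∪ Z)) + r
    main {i} {b} {W} {r} _ b∈ ρ with reach-split {X} {Z} ρ | x∈p∪q⁻ X Z b∈
    ... | W₁ , W₂ , r₁ , r₂ , ρ₁ , ρ₂ , W⊆ , r≤ | inj₁ b∈X = ≤-trans
      (hat≤δ+δ large large′ (∈-∪ʳ X Y g∈Y) (∈-∪ˡ Y Z g∈Y) (∈-∪ˡ X Y b∈X)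
        (reach-map (λ p → _ , ∈-∪ˡ X Y p , refl) ρ₁) (reach-map (λ p → _ , ∈-∪ʳ Y Z p , refl) ρ₂) W⊆)
      (+-mono-≤ ≤-refl r≤)
    ... | W₁ , W₂ , r₁ , r₂ , ρ₁ , ρ₂ , W⊆ , r≤ | inj₂ b∈Z = ≤-trans
      (hat≤δ+δ large′ large (∈-∪ˡ Y Z g∈Y) (∈-∪ʳ X Y g∈Y) (∈-∪ʳ Y Z b∈Z)
        (reach-map (λ p → _ , ∈-∪ʳ Y Z p , refl) ρ₂) (reach-map (λ p → _ , ∈-∪ˡ X Y p , refl) ρ₁)
        (⊆-trans W⊆ (∪-⊆ (q⊆p∪q W₂ W₁) (p⊆p∪q W₁))))
      (+-mono-≤ (≤-reflexive (+-comm _ _)) (≤-trans (≤-reflexive (+-comm _ _)) r≤))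

  -- The diversity B and the embedding of A

  B : Diversity R m
  B = record { d = δ ; nonneg = δ-nonneg ; zero-iff = λ X → δ-zero⁻ X , δ-zero X ; triangle = δ-triangle }

  ι : Fin n → Fin m
  ι a = point λ i → κ i ⟨ a ⟩

  ι-[] : ∀ a i → ι a [ i ] ≡ κ i ⟨ a ⟩
  ι-[] a = point-[] λ i → κ i ⟨ a ⟩

  ι-initial : ∀ a → ι a [ i₀ ] ≡ initial ⟨ a ⟩
  ι-initial a = trans (ι-[] a i₀) (cong (_⟨ a ⟩) κ-i₀)

  -- Coordinate `i₀` of `ι a` contains the fact that connects to `⁅ a ⁆` at no cost. Shared with
  -- `a′`, it bounds the distance of `a` and `a′` by zero.
  ι-injective : ∀ {a a′} → ι a ≡ ι a′ → a ≡ a′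
  ι-injective {a} {a′} e = ∣X∣≤1⇒atMostOne (⁅ a ⁆ ∪ ⁅ a′ ⁆) (proj₁ (zero-iff _)
      (≤-antisym (≤-trans (γ-sound near) (≤-reflexive total-zero)) (nonneg _)))
      (∈-∪ˡ ⁅ a ⁆ ⁅ a′ ⁆ (x∈⁅x⁆ a)) (∈-∪ʳ ⁅ a ⁆ ⁅ a′ ⁆ (x∈⁅x⁆ a′))
    where
    at-a′ : ⟦ initial ⟧ a′ (fact ⁅ a ⁆ 𝟘)
    at-a′ = subst (_∋ fact ⁅ a ⁆ 𝟘) (trans (sym (ι-initial a)) (trans (cong (_[ i₀ ]) e) (ι-initial a′))) (initial-point a)
    near : γ (⁅ a ⁆ ∪ ⁅ a′ ⁆) ≼ 𝟘
    near = subst (λ W → γ (W ∪ ⁅ a′ ⁆) ≼ 𝟘) (lbl-fact ⁅ a ⁆ 𝟘) (≼-trans (system⁻ initial? at-a′) (cost-fact-≼ ⁅ a ⁆ 𝟘))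

  reach-premises : ∀ {Y i W r} → Reach (image R ι Y) i W r → ∃ λ c → Premises ⟦ κ i ⟧ Y W c × total c ≤ r
  reach-premises (nil p q) = 𝟘 , nil p , ≤-trans (≤-reflexive total-zero) q
  reach-premises {i = i} (add {φ = φ} {z = z} b∈ f p ρ q s) with ∈-image⁻ R ι b∈ | reach-premises ρ
  ... | y , y∈ , refl | c , ps , le = z ⊕ c , add y φ (subst (_∋ φ) (ι-[] y i) f) y∈ ps q (⊕-monoˡ c p) ,
    ≤-trans (≤-reflexive (total-+ z c)) (≤-trans (+-mono-≤ ≤-refl le) s)

  -- Closedness of `κ i` bounds the defect: whatever `Y` reaches at cost `c` is derived at each
  -- point of `Y` at cost `γ Y ⊕ c`.
  δ-ι≤d : ∀ Y → δ (image R ι Y) ≤ d Y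
  δ-ι≤d Y = δ≤ (nonneg Y) (λ p → proj₂ (proj₂ (proj₂ η-exists)) Y (p ∘ ∣image∣≤1 R ι)) main
    where
    main : ∀ {i b W r} → ¬ ∣ image R ι Y ∣ ≤ℕ 1 → b ∈ image R ι Y → Reach (image R ι Y) i W r → hat (b [ i ]) W ≤ d Y + r
    main {i} {b} {W} {r} _ b∈ ρ with ∈-image⁻ R ι b∈ | reach-premises ρ
    ... | y , y∈ , refl | c , ps , le = begin
      hat (ι y [ i ]) W     ≡⟨ cong (λ t → hat t W) (ι-[] y i) ⟩
      hat (κ i ⟨ y ⟩) W     ≤⟨ hat≤ (via derived (⊆-reflexive (sym (lbl-fact W (γ Y ⊕ c)))) (cost-fact-≼ W (γ Y ⊕ c))) ⟩
      total (γ Y ⊕ c)       ≡⟨ trans (total-+ (γ Y) c) (cong (_+ total c) (total-γ Y)) ⟩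
      d Y + total c         ≤⟨ +-mono-≤ ≤-refl le ⟩
      d Y + r               ∎
      where
      open ≤-Reasoning
      derived : ⟦ κ i ⟧ y (fact W (γ Y ⊕ c))
      derived = closed-∈ (κ-closed i) λ k → k (derives y∈
        (premises-shrink (⊆-reflexive (lbl-fact W (γ Y ⊕ c))) ps) (≼-cost-fact W (γ Y ⊕ c)))

  reach-self : ∀ {Y} k W → ∣ W ∣ ≤ℕ k → W ⊆ Y → Reach (image R ι Y) i₀ W 0ℝ
  reach-self {Y} k W W≤k W⊆Y with nonempty? W
  ... | no empty = nil (λ {x} x∈ → ⊥-elim (empty (x , x∈))) ≤-refl
  reach-self {Y} zero W W≤k W⊆Y | yes (x , x∈) with () ← ℕₚ.<-≤-trans (x∈p⇒∣p-x∣<∣p∣ x∈) W≤k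
  reach-self {Y} (suc k) W W≤k W⊆Y | yes (x , x∈) = add (∈-image⁺ R ι (W⊆Y x∈))
    (subst (_∋ fact ⁅ x ⁆ 𝟘) (sym (ι-initial x)) (initial-point x)) (cost-fact-≼ ⁅ x ⁆ 𝟘)
    (reach-self k (W - x) (ℕₚ.≤-pred (ℕₚ.<-≤-trans (x∈p⇒∣p-x∣<∣p∣ x∈) W≤k)) (⊆-trans (p─q⊆p W ⁅ x ⁆) W⊆Y))
    cover (≤-reflexive (trans (+-identityʳ _) total-zero))
    where
    cover : W ⊆ lbl (fact ⁅ x ⁆ 𝟘) ∪ (W - x)
    cover {y} y∈ with y ≟ x
    ... | yes refl = ∈-∪ˡ _ (W - x) (subst (x ∈_) (sym (lbl-fact ⁅ x ⁆ 𝟘)) (x∈⁅x⁆ x))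
    ... | no y≢x   = ∈-∪ʳ (lbl (fact ⁅ x ⁆ 𝟘)) (W - x) (x∈p∧x≢y⇒x∈p-y y∈ y≢x)

  d≤hat-initial : ∀ {y Y} → y ∈ Y → d Y ≤ hat (initial ⟨ y ⟩) Y
  d≤hat-initial {y} {Y} y∈ = ≤hat λ where
    _ ceiling        → d-mono ⊆⊤
    _ (via f Y⊆ le) → γ-sound (≼-trans (γ-mono (⊆-trans Y⊆ (p⊆p∪q ⁅ y ⁆))) (≼-trans (system⁻ initial? f) le))

  -- In coordinate `i₀` the set `Y` reaches itself at no cost, while a single point connects to it
  -- at cost at least `d Y`; the defect is therefore at least `d Y`.
  d≤δ-ι : ∀ Y → d Y ≤ δ (image R ι Y)
  d≤δ-ι Y with ∣ Y ∣ ℕₚ.≤? 1 | nonempty? Y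
  ... | yes Y≤1 | _ = ≤-trans (≤-reflexive (proj₂ (zero-iff Y) Y≤1)) (δ-nonneg _)
  ... | no Y≰1 | no empty = ⊥-elim (Y≰1 (atMostOne⇒∣X∣≤1 Y λ {x} x∈ _ → ⊥-elim (empty (x , x∈))))
  ... | no Y≰1 | yes (y , y∈) = begin
    d Y                        ≤⟨ d≤hat-initial y∈ ⟩
    hat (initial ⟨ y ⟩) Y      ≡⟨ cong (λ t → hat t Y) (ι-initial y) ⟨
    hat (ι y [ i₀ ]) Y         ≤⟨ hat≤δ (Y≰1 ∘ ∣image∣≤1⁻ R ι ι-injective) (∈-image⁺ R ι y∈) (reach-self ∣ Y ∣ Y ℕₚ.≤-refl ⊆-refl) ⟩
    δ (image R ι Y) + 0ℝ       ≡⟨ +-identityʳ _ ⟩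
    δ (image R ι Y)            ∎
    where open ≤-Reasoning

  embedding : Embedding R A B
  embedding = record { map = ι ; injective = ι-injective ; preserves = λ X → ≤-antisym (δ-ι≤d X) (d≤δ-ι X) }

  -- Automorphisms that permute coordinates

  module Permute (τ σ : Fin M → Fin M) (τσ : ∀ i → τ (σ i) ≡ i) (στ : ∀ i → σ (τ i) ≡ i) where

    permute : Fin m → Fin m
    permute b = point λ j → b [ τ j ]

    permute-[] : ∀ b j → permute b [ j ] ≡ b [ τ j ]
    permute-[] b = point-[] λ j → b [ τ j ]

    permute-σ : ∀ b i → b [ i ] ≡ permute b [ σ i ]
    permute-σ b i = sym (trans (permute-[] b (σ i)) (cong (b [_]) (τσ i)))

    permute-injective : ∀ {b b′} → permute b ≡ permute b′ → b ≡ b′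
    permute-injective {b} {b′} e = []-ext λ i → trans (permute-σ b i) (trans (cong (_[ σ i ]) e) (sym (permute-σ b′ i)))

    automorphism : Aut R B
    automorphism = record
      { map = permute
      ; injective = permute-injective
      ; surjective = λ b → point (λ j → b [ σ j ]) , λ { refl → []-ext λ j →
          trans (permute-[] _ j) (trans (point-[] _ (τ j)) (cong (b [_]) (στ j))) }
      ; preserves = λ X → ≤-antisym
          (δ-≤-by (∣image∣≤1 R permute) τ λ j b∈ → from (∈-image⁻ R permute b∈))
          (δ-≤-by (∣image∣≤1⁻ R permute permute-injective) σ λ i {b} b∈ → permute b , ∈-image⁺ R permute b∈ , permute-σ b i) }
      where
      from : ∀ {X j b} → (∃ λ b′ → b′ ∈ X × permute b′ ≡ b) → ∃ λ b′ → b′ ∈ X × b [ j ] ≡ b′ [ τ j ]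
      from {j = j} (b′ , b′∈ , refl) = b′ , b′∈ , permute-[] b′ j

  -- Extending partial automorphisms

  -- The map `Ψ` receives its proof irrelevantly. The equations in it are decidable, also those
  -- between reals, so the proof can be recovered.
  recomputed : ∀ {f} → .(IsPartialAut R A f) → IsPartialAut R A f
  recomputed pf = record
    { injective = λ {a} {a′} p q → recompute (a ≟ a′) (IsPartialAut.injective pf p q)
    ; preserves = λ X h → recompute (_ ≟ℝ _) (IsPartialAut.preserves pf X h) }

  maps? : ∀ (f : PMap R n) x y → Dec (lookup f x ≡ just y)
  maps? f x y = Maybeₚ.≡-dec _≟_ (lookup f x) (just y)

  action : ∀ f → IsPartialAut R A f → PartialIso
  action f pf = record
    { _~_ = λ x y → lookup f x ≡ just y
    ; ~? = maps? f
    ; functional = λ p q → Maybeₚ.just-injective (trans (sym p) q)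
    ; injective = IsPartialAut.injective pf
    ; isometric = λ {Z} {Z′} forth back → trans
        (sym (IsPartialAut.preserves pf Z λ x x∈ → let (y , _ , r) = forth x∈ in y , r))
        (cong d (⊆-antisym (into forth) (onto back))) }
    where
    pimage? : ∀ Z y → Dec (∃ λ x → x ∈ Z × lookup f x ≡ just y)
    pimage? Z y = Finₚ.any? λ x → (x ∈? Z) ×-dec maps? f x y
    into : ∀ {Z Z′} → (∀ {x} → x ∈ Z → ∃ λ y → y ∈ Z′ × lookup f x ≡ just y) → pimage R f Z ⊆ Z′
    into {Z} {Z′} forth y∈ = let (x , x∈ , p) = ∈-comprehension⁻ (pimage? Z) y∈ ; (y′ , y′∈ , q) = forth x∈ in
      subst (_∈ Z′) (Maybeₚ.just-injective (trans (sym q) p)) y′∈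
    onto : ∀ {Z Z′} → (∀ {y} → y ∈ Z′ → ∃ λ x → x ∈ Z × lookup f x ≡ just y) → Z′ ⊆ pimage R f Z
    onto {Z} back y∈ = ∈-comprehension⁺ (pimage? Z) (back y∈)

  identityOn : PMap R n → PartialIso
  identityOn f = record
    { _~_ = λ x y → x ≡ y × (∃ λ z → lookup f x ≡ just z)
    ; ~? = λ x y → (x ≟ y) ×-dec Finₚ.any? (maps? f x)
    ; functional = λ { (refl , _) (refl , _) → refl }
    ; injective = λ { (refl , _) (refl , _) → refl }
    ; isometric = λ {Z} {Z′} forth back → cong d (⊆-antisym
        (λ x∈ → let (y , y∈ , (e , _)) = forth x∈ in subst (_∈ Z′) (sym e) y∈)
        (λ y∈ → let (x , x∈ , (e , _)) = back y∈ in subst (_∈ Z) e x∈)) }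

  open PartialIso using (_~_)

  key : PartialIso → Fin M → Fin S
  key I i = pull I (κ i)

  RangeOf : PartialIso → Fin n → Set
  RangeOf I y = ∃ λ x → _~_ I x y

  -- A pullback determines, and is determined by, the decoration on the range; hence a smaller range
  -- gives a coarser partition of the coordinates.
  key-kernel : ∀ I J → (∀ y → RangeOf J y → RangeOf I y) → ∀ i j → key I i ≡ key I j → key J i ≡ key J j
  key-kernel I J J⊆I i j e = ⟨⟩-ext λ x → ∋-ext (transfer x i j (λ y r → agree y r)) (transfer x j i (λ y r → sym (agree y r)))
    where
    agree : ∀ y → RangeOf J y → κ i ⟨ y ⟩ ≡ κ j ⟨ y ⟩
    agree y r = let (x , s) = J⊆I y r in trans (sym (pull-⟨⟩ I s)) (trans (cong (_⟨ x ⟩) e) (pull-⟨⟩ I s))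
    transfer : ∀ x i j → (∀ y → RangeOf J y → κ i ⟨ y ⟩ ≡ κ j ⟨ y ⟩) → ∀ φ → ⟦ key J i ⟧ x φ → ⟦ key J j ⟧ x φ
    transfer x i j ag φ p = let (y , r , q) = pull⁻ J p in
      pull⁺ J r (subst (_∋ φ) (ag y (x , r)) q)

  index-same-range : ∀ I J → (∀ y → RangeOf I y → RangeOf J y) → (∀ y → RangeOf J y → RangeOf I y) →
                     ∀ i → index (key I) i ≡ index (key J) i
  index-same-range I J p q = index-kernel (key I) (key J) (key-kernel I J q) (key-kernel J I p)

  -- Coordinate j of the image of b is coordinate τ j of b, where the restriction of κ (τ j) to the
  -- domain of f is the pullback of κ j along f.
  module Coordinates (f : PMap R n) (pf : IsPartialAut R A f) where
    source target : PartialIso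
    source = identityOn f
    target = action f pf

    fibres : SameFibres (key source) (key target)
    fibres = pull-fibres source target (λ x (_ , _ , r) → r) (λ x r → x , refl , r)

    fibres⁻ : SameFibres (key target) (key source)
    fibres⁻ s = sym (fibres s)

    abstract
      τ : Fin M → Fin M
      τ = match (key source) (key target) fibres

      σ : Fin M → Fin M
      σ = match (key target) (key source) fibres⁻

      τσ : ∀ i → τ (σ i) ≡ i
      τσ = match-inverse (key source) (key target) fibres fibres⁻

      στ : ∀ i → σ (τ i) ≡ i
      στ = match-inverse (key target) (key source) fibres⁻ fibres

      τ-key : ∀ j → key source (τ j) ≡ key target j
      τ-key = match-key (key source) (key target) fibres

      τ-index : ∀ j → index (key source) (τ j) ≡ index (key target) j
      τ-index = match-index (key source) (key target) fibres

    τ-value : ∀ {x y} → lookup f x ≡ just y → ∀ j → κ (τ j) ⟨ x ⟩ ≡ κ j ⟨ y ⟩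
    τ-value {x} {y} r j = trans (sym (pull-⟨⟩ source (refl , y , r))) (trans (cong (_⟨ x ⟩) (τ-key j)) (pull-⟨⟩ target r))

    open Permute τ σ τσ στ public

  open Coordinates using (τ; τ-key; τ-index; τ-value; automorphism; permute; permute-[])

  τ-unique : ∀ f pf j i → key (identityOn f) i ≡ key (action f pf) j →
             index (key (identityOn f)) i ≡ index (key (action f pf)) j → τ f pf j ≡ i
  τ-unique f pf j i e ix = index-injective (key (identityOn f)) (τ f pf j) i
    (trans (τ-key f pf j) (sym e)) (trans (τ-index f pf j) (sym ix))

  -- Coherence

  module Composition (f g : PMap R n) (pf : IsPartialAut R A f) (pg : IsPartialAut R A g)
    (pgf : IsPartialAut R A (_∘ₚ_ R g f))
    (Dg⊆Rf : ∀ b → Dom R g b → Range R f b) (Rf⊆Dg : ∀ b → Range R f b → Dom R g b) where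

    gf : PMap R n
    gf = _∘ₚ_ R g f

    compose⁺ : ∀ {a b c} → lookup f a ≡ just b → lookup g b ≡ just c → lookup gf a ≡ just c
    compose⁺ {a} p q = trans (Vecₚ.lookup∘tabulate _ a) (trans (cong (_>>= lookup g) p) q)

    compose⁻ : ∀ {a c} → lookup gf a ≡ just c → ∃ λ b → lookup f a ≡ just b × lookup g b ≡ just c
    compose⁻ {a} p = split (lookup f a) refl (trans (sym (Vecₚ.lookup∘tabulate _ a)) p)
      where
      split : ∀ {c} mb → lookup f a ≡ mb → (mb >>= lookup g) ≡ just c → ∃ λ b → lookup f a ≡ just b × lookup g b ≡ just c
      split (just b) e q = b , e , q

    dom⁺ : ∀ {a} → Dom R f a → Dom R gf a
    dom⁺ {a} (b , p) = let (c , q) = Rf⊆Dg b (a , p) in c , compose⁺ p q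

    dom⁻ : ∀ {a} → Dom R gf a → Dom R f a
    dom⁻ (c , p) = let (b , q , _) = compose⁻ p in b , q

    path : Fin M → Fin M
    path j = τ f pf (τ g pg j)

    path-value : ∀ j {x z} → lookup gf x ≡ just z → κ (path j) ⟨ x ⟩ ≡ κ j ⟨ z ⟩
    path-value j r = let (y , p , q) = compose⁻ r in trans (τ-value f pf p (τ g pg j)) (τ-value g pg q j)

    path-key : ∀ j → key (identityOn gf) (path j) ≡ key (action gf pgf) j
    path-key j = ⟨⟩-ext λ x → ∋-ext (to x) (from x)
      where
      to : ∀ x φ → ⟦ key (identityOn gf) (path j) ⟧ x φ → ⟦ key (action gf pgf) j ⟧ x φ
      to x φ p = let (y , (x≡y , z , r) , q) = pull⁻ (identityOn gf) p in
        pull⁺ (action gf pgf) r (subst (_∋ φ) (path-value j r) (subst (λ w → ⟦ κ (path j) ⟧ w φ) (sym x≡y) q))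
      from : ∀ x φ → ⟦ key (action gf pgf) j ⟧ x φ → ⟦ key (identityOn gf) (path j) ⟧ x φ
      from x φ p = let (z , r , q) = pull⁻ (action gf pgf) p in
        pull⁺ (identityOn gf) (refl , z , r) (subst (_∋ φ) (sym (path-value j r)) q)

    index-source : ∀ i → index (key (identityOn gf)) i ≡ index (key (identityOn f)) i
    index-source = index-same-range (identityOn gf) (identityOn f)
      (λ { y (x , refl , r) → x , refl , dom⁻ r }) (λ { y (x , refl , r) → x , refl , dom⁺ r })

    index-middle : ∀ i → index (key (action f pf)) i ≡ index (key (identityOn g)) i
    index-middle = index-same-range (action f pf) (identityOn g)
      (λ y r → y , refl , Rf⊆Dg y r) (λ { y (x , refl , r) → Dg⊆Rf y r })

    index-target : ∀ i → index (key (action g pg)) i ≡ index (key (action gf pgf)) i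
    index-target = index-same-range (action g pg) (action gf pgf)
      (λ z (y , r) → let (x , s) = Dg⊆Rf y (z , r) in x , compose⁺ s r)
      (λ z (x , r) → let (y , _ , s) = compose⁻ r in y , s)

    -- Both matchings preserve indices, and the range of `f` is the domain of `g`, so
    -- `index-same-range` links one matching to the next.
    path-index : ∀ j → index (key (identityOn gf)) (path j) ≡ index (key (action gf pgf)) j
    path-index j = trans (index-source (path j)) (trans (τ-index f pf (τ g pg j))
      (trans (index-middle (τ g pg j)) (trans (τ-index g pg j) (index-target j))))

    -- Key and index determine a coordinate, and `path j` has those that define `τ gf pgf j`.
    τ-∘ : ∀ j → τ gf pgf j ≡ path j
    τ-∘ j = τ-unique gf pgf j (path j) (path-key j) (path-index j)

    permute-∘ : ∀ b → permute gf pgf b ≡ permute g pg (permute f pf b)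
    permute-∘ b = []-ext λ j → begin
      permute gf pgf b [ j ]              ≡⟨ permute-[] gf pgf b j ⟩
      b [ τ gf pgf j ]                    ≡⟨ cong (b [_]) (τ-∘ j) ⟩
      b [ path j ]                        ≡⟨ permute-[] f pf b (τ g pg j) ⟨
      permute f pf b [ τ g pg j ]         ≡⟨ permute-[] g pg (permute f pf b) j ⟨
      permute g pg (permute f pf b) [ j ] ∎
      where open ≡-Reasoning

  permute-extends : ∀ f pf {a b} → lookup f a ≡ just b → permute f pf (ι a) ≡ ι b
  permute-extends f pf {a} {b} r = []-ext λ j → trans (permute-[] f pf (ι a) j)
    (trans (ι-[] a (τ f pf j)) (trans (τ-value f pf r j) (sym (ι-[] b j))))

  witness : CoherentEPPAWitness R A B embedding
  witness = record
    { Ψ = λ f pf → automorphism f (recomputed pf)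
    ; extends = λ f pf a b r → permute-extends f (recomputed pf) r
    ; coherent = λ f g pf pg pgf Dg⊆Rf Rf⊆Dg →
        Composition.permute-∘ f g (recomputed pf) (recomputed pg) (recomputed pgf) Dg⊆Rf Rf⊆Dg }

theorem7p10 : (R : RealField) → HasCoherentEPPA R
theorem7p10 R n A = m , B , embedding , witness
  where open Extension R A
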